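{- Every $3$-vexillary permutation is multiplicity free.
   Context: Let $s_i=(i\ i{+}1)$, $\ell(w)$ the Coxeter length, and $\mathrm{Red}(w)$ the set of reduced words of a permutation $w$: sequences $a=(a_1,\dots,a_{\ell(w)})$ with $s_{a_1}\cdots s_{a_{\ell(w)}}=w$ (right multiplication by $s_i$ swaps the entries in positions $i$ and $i+1$). For $a\in\mathrm{Red}(w)$ let $I(a)$ be the set of integer sequences $1\le i_1\le\cdots\le i_{\ell(w)}$ such that $i_j<i_{j+1}$ whenever $a_j<a_{j+1}$. The Stanley symmetric function is $F_w=\sum_{a\in\mathrm{Red}(w)}\sum_{i\in I(a)}x_{i_1}\cdots x_{i_{\ell(w)}}$. It is symmetric with Schur expansion $F_w=\sum_\lambda a_{w\lambda}s_\lambda$, where the $a_{w\lambda}$ are nonnegative integers. The Edelman-Greene number is $EG(w)=\sum_\lambda a_{w\lambda}$. A permutation $w$ is $3$-vexillary if $EG(w)\le 3$, and multiplicity free if all nonzero coefficients $a_{w\lambda}$ equal $1$. -}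

module Defs where

open import Data.Nat.Base using (ℕ; zero; suc; pred; _*_; _≤_; _<_; _≥_)
open import Data.Nat.ListAction using (sum)
import Data.Nat.Properties as ℕ
open import Data.Fin.Base as Fin using (Fin; zero; suc; inject₁; toℕ; fromℕ<)
open import Data.Fin.Properties using (_≟_; _≤?_; _<?_; all?; toℕ-fromℕ<; toℕ<n)
open import Data.Fin.Permutation using (Permutation′; _⟨$⟩ʳ_; _≈_; id; _∘ₚ_; transpose)
open import Data.List.Base using (List; []; _∷_; map; filter; length; concat; allFin; cartesianProductWith)
open import Data.List.Membership.Propositional using (_∈_; _∉_)
open import Data.List.Membership.Propositional.Properties using (∈-cartesianProductWith⁺; ∈-allFin)
open import Data.List.Relation.Unary.All as All using (All)
open import Data.List.Relation.Unary.Any using (here)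
open import Data.List.Relation.Unary.Linked as Linked using (Linked)
open import Data.List.Relation.Unary.Unique.Propositional using (Unique)
open import Data.Vec.Base as Vec using (Vec; []; _∷_; toList; tabulate)
open import Data.Vec.Properties using (≡-dec)
open import Data.Product.Base using (_×_; _,_)
open import Relation.Nullary.Decidable using (Dec; yes; no; map′; _×-dec_; _→-dec_; ¬?)
open import Relation.Nullary.Negation using (¬_)
open import Relation.Binary.PropositionalEquality using (_≡_; _≢_; refl; subst)

-- All words of length k in the given letters.
tuples : ∀ {A : Set} → List A → (k : ℕ) → List (Vec A k)
tuples xs zero    = [] ∷ []
tuples xs (suc k) = cartesianProductWith _∷_ xs (tuples xs k)

words : (m k : ℕ) → List (Vec (Fin m) k)
words m = tuples (allFin m)

∈-words : ∀ {m k} (a : Vec (Fin m) k) → a ∈ words m k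
∈-words []      = here refl
∈-words (x ∷ a) = ∈-cartesianProductWith⁺ _∷_ (∈-allFin x) (∈-words a)

------------------------------------------------------------------------
-- Formal power series in x₁, x₂, …

-- f k (α₁ ∷ … ∷ αₖ ∷ []) is the coefficient of x₁^α₁ ⋯ xₖ^αₖ. All series below
-- have coefficients in ℕ.
Series : Set
Series = ∀ k → Vec ℕ k → ℕ

-- The exponent vector of the product of the variables x_i over i in the list
-- (variables are numbered from 0).
content : ∀ {k} → List (Fin k) → Vec ℕ k
content is = tabulate (λ v → length (filter (v ≟_) is))

hasContent? : ∀ {k} (α : Vec ℕ k) (is : List (Fin k)) → Dec (content is ≡ α)
hasContent? α is = ≡-dec ℕ._≟_ (content is) α

------------------------------------------------------------------------
-- Reduced words

-- Letters are numbered from 0: the letter i swaps i and i+1 in {0, …, n-1}.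
s : ∀ {n} → Fin (pred n) → Permutation′ n
s {suc n} i = transpose (inject₁ i) (suc i)

-- The group product s_{a₁} ⋯ s_{aₖ}, where (u v)(j) = u(v(j)); the library's
-- _∘ₚ_ composes in the opposite order.
product : ∀ {n k} → Vec (Fin (pred n)) k → Permutation′ n
product []      = id
product (i ∷ a) = product a ∘ₚ s i

-- The second component says that k is the Coxeter length of w, i.e. the least
-- length of a word with product w.
Reduced : ∀ {n} → Permutation′ n → ∀ {k} → Vec (Fin (pred n)) k → Set
Reduced {n} w {k} a =
  product a ≈ w × (∀ {m} (b : Vec (Fin (pred n)) m) → product b ≈ w → k ≤ m)

product≈? : ∀ {n k} (w : Permutation′ n) (a : Vec (Fin (pred n)) k) → Dec (product a ≈ w)
product≈? w a = all? (λ i → (product a ⟨$⟩ʳ i) ≟ (w ⟨$⟩ʳ i))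

reduced? : ∀ {n} (w : Permutation′ n) {k} (a : Vec (Fin (pred n)) k) → Dec (Reduced w a)
reduced? {n} w {k} a = product≈? w a ×-dec map′ to from
  (all? λ (m : Fin k) → All.all? (λ b → ¬? (product≈? w b)) (words (pred n) (toℕ m)))
  where
  NoneShorter : Set
  NoneShorter = ∀ (m : Fin k) → All (λ b → ¬ (product b ≈ w)) (words (pred n) (toℕ m))

  Minimal : Set
  Minimal = ∀ {m} (b : Vec (Fin (pred n)) m) → product b ≈ w → k ≤ m

  to : NoneShorter → Minimal
  to none {m} b pb = ℕ.≮⇒≥ λ m<k →
    All.lookup
      (subst (λ l → All (λ b → ¬ (product b ≈ w)) (words (pred n) l))
             (toℕ-fromℕ< m<k) (none (fromℕ< m<k)))
      (∈-words b) pb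

  from : Minimal → NoneShorter
  from min m = All.tabulate λ {b} _ pb → ℕ.<⇒≱ (toℕ<n m) (min b pb)

-- The reduced words of w having length d: all of Red(w) if d = ℓ(w), and none
-- otherwise.
Red : ∀ {n} → Permutation′ n → (d : ℕ) → List (Vec (Fin (pred n)) d)
Red {n} w d = filter (reduced? w) (words (pred n) d)

------------------------------------------------------------------------
-- Stanley symmetric functions

-- A step from (a_j , i_j) to (a_{j+1} , i_{j+1}).
Step : ∀ {m k} → Fin m × Fin k → Fin m × Fin k → Set
Step (a , i) (a′ , i′) = i Fin.≤ i′ × (a Fin.< a′ → i Fin.< i′)

step? : ∀ {m k} (p q : Fin m × Fin k) → Dec (Step p q)
step? (a , i) (a′ , i′) = (i ≤? i′) ×-dec ((a <? a′) →-dec (i <? i′))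

Compatible : ∀ {m k d} → Vec (Fin m) d → Vec (Fin k) d → Set
Compatible a is = Linked Step (toList (Vec.zip a is))

compatible? : ∀ {m k d} (a : Vec (Fin m) d) (is : Vec (Fin k) d) → Dec (Compatible a is)
compatible? a is = Linked.linked? step? (toList (Vec.zip a is))

-- The sequences in I(a) that involve only the first k variables.
I : ∀ {m d} → Vec (Fin m) d → (k : ℕ) → List (Vec (Fin k) d)
I {d = d} a k = filter (compatible? a) (words k d)

-- Only words of length |α| can contribute to the coefficient of x^α.
stanley : ∀ {n} → Permutation′ n → Series
stanley w k α =
  sum (map (λ a → length (filter (λ is → hasContent? α (toList is)) (I a k)))
           (Red w (Vec.sum α)))

------------------------------------------------------------------------
-- Schur functions

record Partition : Set where
  field
    parts      : List ℕ
    decreasing : Linked _≥_ parts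
    positive   : All (0 <_) parts

open Partition public

-- A filling of a diagram is its list of rows, from the longest one on.
Filling : ℕ → Set
Filling k = List (List (Fin k))

fillings : (k : ℕ) → List ℕ → List (Filling k)
fillings k []       = [] ∷ []
fillings k (r ∷ rs) = cartesianProductWith _∷_ (map toList (words k r)) (fillings k rs)

-- us Above vs: the row vs fits below us with columns strictly increasing.
data _Above_ {k : ℕ} : List (Fin k) → List (Fin k) → Set where
  []  : ∀ {us} → us Above []
  _∷_ : ∀ {u v us vs} → u Fin.< v → us Above vs → (u ∷ us) Above (v ∷ vs)

above? : ∀ {k} (us vs : List (Fin k)) → Dec (us Above vs)
above? us       []       = yes []
above? []       (v ∷ vs) = no λ ()
above? (u ∷ us) (v ∷ vs) =
  map′ (λ (p , q) → p ∷ q) (λ { (p ∷ q) → p , q }) ((u <? v) ×-dec above? us vs)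

Semistandard : ∀ {k} → Filling k → Set
Semistandard T = All (Linked Fin._≤_) T × Linked _Above_ T

semistandard? : ∀ {k} (T : Filling k) → Dec (Semistandard T)
semistandard? T = All.all? (Linked.linked? _≤?_) T ×-dec Linked.linked? above? T

-- Semistandard tableaux of shape μ with entries among the first k variables.
SSYT : Partition → (k : ℕ) → List (Filling k)
SSYT μ k = filter semistandard? (fillings k (parts μ))

schur : Partition → Series
schur μ k α = length (filter (λ T → hasContent? α (concat T)) (SSYT μ k))

------------------------------------------------------------------------
-- Schur expansions

-- f = Σ_μ (coeff μ) s_μ, a finite sum with coefficients in ℕ; the coefficients
-- vanish outside the list support. The Schur functions being linearly
-- independent, f determines coeff.
record SchurExpansion (f : Series) : Set where
  field
    coeff   : Partition → ℕ
    support : List Partition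
    unique  : Unique support
    outside : ∀ {μ} → μ ∉ support → coeff μ ≡ 0
    expands : ∀ k (α : Vec ℕ k) → f k α ≡ sum (map (λ μ → coeff μ * schur μ k α) support)

open SchurExpansion public

-- For f = stanley w, coeff is μ ↦ a_{wμ} and this is the Edelman-Greene number
-- EG(w).
EG : ∀ {f} → SchurExpansion f → ℕ
EG E = sum (map (coeff E) (support E))

Vexillary : ℕ → ∀ {n} (w : Permutation′ n) → SchurExpansion (stanley w) → Set
Vexillary k w E = EG E ≤ k

MultiplicityFree : ∀ {n} (w : Permutation′ n) → SchurExpansion (stanley w) → Set
MultiplicityFree w E = ∀ μ → coeff E μ ≢ 0 → coeff E μ ≡ 1

{-# OPTIONS --safe #-}

-- Both F_w and s_λ are sums over words a (the reduced words of w, and the lattice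
-- words of shape λ) of the sum over I(a). Applied to the one-line notation of
-- w⁻¹, a reduced word with a compatible sequence is a sorting process in which
-- each block of equal indices lowers every entry of the Lehmer code by at most
-- one. Hence the exponents of F_w are dominated by the partition conjugate to the
-- sorted code, and the corresponding monomial has coefficient 1, since a block
-- that lowers all nonzero entries is unique. So some shape κ dominates all
-- shapes of F_w and has coefficient 1. Counting words by their ascents shows
-- that the expansion of F_w persists when ascents and non-ascents are exchanged;
-- the same argument, for w conjugated by the longest permutation, then gives a
-- shape κ′ with coefficient 1 whose transpose dominates all transposed shapes. A
-- coefficient other than 0 and 1 belongs to a third shape μ unless κ = κ′, so
-- that EG(w) ≥ 2 + 1 + 1; and κ = κ′ forces μ = κ, as transposition reverses
-- dominance.

module Submission where

open import Defs
open import Data.Bool.Base as Bool using (true; false; Bool; not)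
import Data.Bool.Properties as Bool
open import Data.Fin.Base as Fin using (Fin; zero; suc; inject₁; toℕ; fromℕ<; opposite)
open import Data.Fin.Permutation as Permutation using (Permutation′; _⟨$⟩ʳ_; _⟨$⟩ˡ_; _≈_; _∘ₚ_; inverseˡ; inverseʳ; reverse)
import Data.Fin.Permutation.Components as PC
open import Data.Fin.Properties as Fin using (opposite-involutive; opposite-prop; toℕ-fromℕ<; toℕ-injective; _<?_; _≟_)
open import Data.List.Base as List using (List; []; _∷_; map; filter; length; concat; concatMap; replicate; _++_; allFin; take)
open import Data.List.Membership.DecPropositional using (_∈?_)
open import Data.List.Membership.Propositional using (_∈_)
open import Data.List.Membership.Propositional.Properties using (∈-tabulate⁺; ∈-tabulate⁻; ∈-allFin; ∈-filter⁺; ∈-filter⁻; ∈-map⁺; ∈-map⁻; ∈-cartesianProductWith⁺; ∈-cartesianProductWith⁻; ∈-lookup; ∈-∃++)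
open import Data.List.Membership.Propositional.Properties.WithK using (unique∧set⇒bag)
open import Data.List.Properties as List using (filter-accept; filter-reject; length-filter; length-tabulate; tabulate-cong; filter-all; filter-none; ∷-injective; ∷-injectiveʳ; filter-++; length-++; map-cong; map-∘; map-id; map-++; length-map; ++-identityʳ; map-tabulate; tabulate-lookup; length-replicate; length-take; concatMap-cong; take-map)
open import Data.List.Relation.Binary.BagAndSetEquality using (∼bag⇒↭)
open import Data.List.Relation.Binary.Disjoint.Propositional using (Disjoint)
open import Data.List.Relation.Binary.Permutation.Propositional using (_↭_; prep; swap; ↭-refl; ↭-sym; ↭-trans; ↭⇒↭ₛ; ↭-reflexive)
open import Data.List.Relation.Binary.Permutation.Propositional.Properties as Perm using (↭-length; filter-↭; shift; ++⁺ˡ; ∈-resp-↭)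
import Data.List.Relation.Binary.Permutation.Setoid.Properties as Permₛ
open import Data.List.Relation.Binary.Pointwise using (Pointwise-≡⇒≡)
open import Data.List.Relation.Binary.Prefix.Heterogeneous as Prefix using (Prefix; []; _∷_)
import Data.List.Relation.Binary.Prefix.Heterogeneous.Properties as Prefix
open import Data.List.Relation.Unary.All as All using (All; []; _∷_)
import Data.List.Relation.Unary.All.Properties as All
open import Data.List.Relation.Unary.AllPairs as AllPairs using (AllPairs; []; _∷_)
import Data.List.Relation.Unary.AllPairs.Properties as AllPairs
open import Data.List.Relation.Unary.Any using (here; there)
open import Data.List.Relation.Unary.Linked as Linked using (Linked; []; [-]; _∷_)
import Data.List.Relation.Unary.Linked.Properties as Linked
open import Data.List.Relation.Unary.Sorted.TotalOrder.Properties using (↗↭↗⇒≋)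
open import Data.List.Relation.Unary.Unique.Propositional using (Unique)
import Data.List.Relation.Unary.Unique.Propositional.Properties as Unique
open import Data.Nat.Base using (ℕ; zero; suc; pred; _+_; _*_; _∸_; _⊓_; _⊔_; _≤_; _<_; z≤n; s≤s; z<s; s<s; s≤s⁻¹; _≥_)
open import Data.Nat.ListAction using (sum)
open import Data.Nat.ListAction.Properties using (sum-↭)
import Data.Nat.Properties as ℕ
open import Data.Product.Base using (_×_; _,_; ∃; ∃₂; proj₁; proj₂; -,_)
import Data.Product.Properties as Product
open import Data.Sum.Base using (_⊎_; inj₁; inj₂)
open import Data.Unit.Base using (⊤; tt)
open import Data.Vec.Base as Vec using (Vec; []; _∷_; toList; lookup)
import Data.Vec.Properties as Vec
open import Function.Base using (_∘_; _on_; flip)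
open import Function.Bundles using (mk⇔)
open import Level using (0ℓ)
open import Relation.Binary.Bundles using (DecTotalOrder)
import Relation.Binary.Construct.Flip.EqAndOrd as Flip
open import Relation.Binary.Definitions using (tri<; tri≈; tri>; Transitive)
open import Relation.Binary.PropositionalEquality using (_≡_; _≢_; refl; sym; trans; cong; cong₂; subst; subst₂; module ≡-Reasoning; setoid; isEquivalence)
open import Relation.Binary.Structures using (IsStrictTotalOrder)
open import Relation.Nullary.Decidable using (Dec; yes; no; does; dec-true; dec-false; map′; _×-dec_; _→-dec_; ¬?; decidable-stable)
open import Relation.Nullary.Negation using (¬_; contradiction)
open import Relation.Unary using (Pred; Decidable)

-- One extreme shape would not suffice: beside a coefficient of at least 2 it yields only EG(w) ≥ 2
-- + 1, which the hypothesis allows. Hence the second one, from the transposed side. A block lowers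
-- an entry at most once because its letters decrease: a letter `a` moves the lowered entry to
-- position a+1, and the remaining letters of the block touch only positions up to a. An expansion
-- is given only as an identity of monomial coefficients. For a nondecreasing index sequence `is`,
-- the coefficient of its monomial counts the words compatible with `is`, both in F_w and in each
-- Schur function, and the argument runs on these counts. They and the coefficients are natural
-- numbers, so nothing cancels: each monomial of a shape that occurs is a monomial of F_w.
-- Conjugation by the longest permutation reverses the alphabet and so exchanges ascents with
-- descents; in a reduced word the descents are exactly the non-ascents, as neighbouring letters
-- differ.

private variable
  A B : Set
  P Q : Pred A 0ℓ
  a a′ b c d i k k′ K m n p p′ v : ℕ
  C C′ C″ as as′ is : List ℕ

-- Cancelling descents in a code

-- A code is a list of naturals. Cancelling a descent of a sequence at the
-- positions a, a+1 acts on its Lehmer code as follows.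
infix 4 _—[_]→_
data _—[_]→_ : List ℕ → ℕ → List ℕ → Set where
  here  : b ≤ c → suc c ∷ b ∷ C —[ 0 ]→ b ∷ c ∷ C
  there : C —[ a ]→ C′ → c ∷ C —[ suc a ]→ c ∷ C′

data Path : List ℕ → List ℕ → Set where
  []  : All (_≡ 0) C → Path C []
  _∷_ : C —[ a ]→ C′ → Path C′ as → Path C (a ∷ as)

-- Run C v p as is: the path as from C is cut by is into strictly decreasing
-- blocks, one for each value in is; the current block has value v and goes on
-- with letters less than p.
data Run : List ℕ → ℕ → ℕ → List ℕ → List ℕ → Set where
  []    : All (_≡ 0) C → Run C v p [] []
  same  : C —[ a ]→ C′ → a < p → Run C′ v a as is → Run C v p (a ∷ as) (v ∷ is)
  later : C —[ a ]→ C′ → v < i → Run C′ i a as is → Run C v p (a ∷ as) (i ∷ is)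

-- On the indices of a monomial this is the sum of its first `k` exponents, so that a pointwise
-- comparison of `below` is dominance of contents; on the tail of a one-line notation it is an entry
-- of the Lehmer code.
below : ℕ → List ℕ → ℕ
below k is = length (filter (ℕ._<? k) is)

below-< : ∀ {i} is → i < k → below k (i ∷ is) ≡ suc (below k is)
below-< {k} is i<k = cong length (filter-accept (ℕ._<? k) i<k)

below-≥ : ∀ {i} is → k ≤ i → below k (i ∷ is) ≡ below k is
below-≥ {k} is k≤i = cong length (filter-reject (ℕ._<? k) (ℕ.≤⇒≯ k≤i))

-- An entry c of the code is still available to c blocks. Of the current and
-- the next k blocks, the current one is closed to the entries from p on.
Φ : List ℕ → ℕ → ℕ → ℕ
Φ []      p       k = 0
Φ (c ∷ C) zero    k = c ⊓ k + Φ C zero k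
Φ (c ∷ C) (suc p) k = c ⊓ suc k + Φ C p k

-- The number of cells in the first `k` columns of the diagram with rows `C`: a partial sum of the
-- partition conjugate to the sorted `C`.
∑⊓ : List ℕ → ℕ → ℕ
∑⊓ C k = sum (map (_⊓ k) C)

Φ-closed : ∀ C k → Φ C 0 k ≡ ∑⊓ C k
Φ-closed []      k = refl
Φ-closed (c ∷ C) k = cong (c ⊓ k +_) (Φ-closed C k)

Φ-open : ∀ C k → Φ C (length C) k ≡ ∑⊓ C (suc k)
Φ-open []      k = refl
Φ-open (c ∷ C) k = cong (c ⊓ suc k +_) (Φ-open C k)

∑⊓-mono : ∀ C → k ≤ k′ → ∑⊓ C k ≤ ∑⊓ C k′
∑⊓-mono []      k≤ = z≤n
∑⊓-mono (c ∷ C) k≤ = ℕ.+-mono-≤ (ℕ.⊓-monoʳ-≤ c k≤) (∑⊓-mono C k≤)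

∑⊓-zero : ∀ C → ∑⊓ C 0 ≡ 0
∑⊓-zero []      = refl
∑⊓-zero (c ∷ C) = cong₂ _+_ (ℕ.⊓-zeroʳ c) (∑⊓-zero C)

Φ-lower : ∀ C p k → ∑⊓ C k ≤ Φ C p k
Φ-lower []      p       k = z≤n
Φ-lower (c ∷ C) zero    k = ℕ.≤-reflexive (sym (Φ-closed (c ∷ C) k))
Φ-lower (c ∷ C) (suc p) k = ℕ.+-mono-≤ (ℕ.⊓-monoʳ-≤ c (ℕ.n≤1+n k)) (Φ-lower C p k)

Φ-upper : ∀ C p k → Φ C p k ≤ ∑⊓ C (suc k)
Φ-upper []      p       k = z≤n
Φ-upper (c ∷ C) zero    k = ℕ.≤-trans (ℕ.≤-reflexive (Φ-closed (c ∷ C) k)) (∑⊓-mono (c ∷ C) (ℕ.n≤1+n k))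
Φ-upper (c ∷ C) (suc p) k = ℕ.+-monoʳ-≤ (c ⊓ suc k) (Φ-upper C p k)

Φ-jump : ∀ C p p′ → k < k′ → Φ C p k ≤ Φ C p′ k′
Φ-jump C p p′ k<k′ = ℕ.≤-trans (Φ-upper C p _) (ℕ.≤-trans (∑⊓-mono C k<k′) (Φ-lower C p′ _))

swap-sum : ∀ x y z → x + (y + z) ≡ y + (x + z)
swap-sum x y z = trans (sym (ℕ.+-assoc x y z)) (trans (cong (_+ z) (ℕ.+-comm x y)) (ℕ.+-assoc y x z))

Φ-closed-≤ : ∀ C p k → Φ C 0 k ≤ Φ C p k
Φ-closed-≤ C p k = subst (_≤ Φ C p k) (sym (Φ-closed C k)) (Φ-lower C p k)

-- The moved entry `suc c` is open and counts `suc (c ⊓ k)`. After the step the bound is its old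
-- position, so it counts `c ⊓ k` at its new place; the entries to its right are closed as well,
-- which can only lower their share.
Φ-step : C —[ a ]→ C′ → a < p → ∀ k → suc (Φ C′ a k) ≤ Φ C p k
Φ-step {suc c ∷ b ∷ C} {p = suc p} (here _) _ k = s≤s (begin
  b ⊓ k + (c ⊓ k + Φ C 0 k)   ≡⟨ swap-sum (b ⊓ k) (c ⊓ k) _ ⟩
  c ⊓ k + (b ⊓ k + Φ C 0 k)   ≤⟨ ℕ.+-monoʳ-≤ (c ⊓ k) (Φ-closed-≤ (b ∷ C) p k) ⟩
  c ⊓ k + Φ (b ∷ C) p k       ∎)
  where open ℕ.≤-Reasoning
Φ-step {c ∷ C} {p = suc p} (there s) (s≤s a<p) k =
  ℕ.≤-trans (ℕ.≤-reflexive (sym (ℕ.+-suc (c ⊓ suc k) _))) (ℕ.+-monoʳ-≤ (c ⊓ suc k) (Φ-step s a<p k))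

Φ-positive : C —[ a ]→ C′ → a < p → 0 < Φ C p 0
Φ-positive s a<p = ℕ.≤-trans (s≤s z≤n) (Φ-step s a<p 0)

-- Skipping the movable position a′ in favour of a smaller one loses an entry
-- for the current block.
Φ-skip : C —[ a ]→ C′ → C —[ a′ ]→ C″ → a < a′ → a′ < p → suc (Φ C′ a 0) < Φ C p 0
Φ-skip {suc c ∷ b ∷ C} {p = suc p} (here _) (there s) _ (s≤s a<p) = s≤s (begin-strict
  b ⊓ 0 + (c ⊓ 0 + Φ C 0 0)
    ≡⟨ cong₂ _+_ (ℕ.⊓-zeroʳ b) (cong₂ _+_ (ℕ.⊓-zeroʳ c) (trans (Φ-closed C 0) (∑⊓-zero C))) ⟩
  0                         <⟨ Φ-positive s a<p ⟩
  Φ (b ∷ C) p 0             ≤⟨ ℕ.m≤n+m _ (c ⊓ 0) ⟩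
  c ⊓ 0 + Φ (b ∷ C) p 0     ∎)
  where open ℕ.≤-Reasoning
Φ-skip {c ∷ C} (there s) (there s′) (s≤s a<a′) (s≤s a′<p) =
  ℕ.≤-trans (ℕ.≤-reflexive (sym (trans (ℕ.+-suc (c ⊓ 1) _) (cong suc (ℕ.+-suc (c ⊓ 1) _)))))
            (ℕ.+-monoʳ-≤ (c ⊓ 1) (Φ-skip s s′ a<a′ a′<p))

Run-below : Run C v p as is → ∀ k → k ≤ v → below k is ≡ 0
Run-below ([] _) k k≤v = refl
Run-below {is = _ ∷ is} (same _ _ r)    k k≤v = trans (below-≥ is k≤v) (Run-below r k k≤v)
Run-below {is = _ ∷ is} (later _ v<i r) k k≤v =
  trans (below-≥ is (ℕ.≤-trans k≤v (ℕ.<⇒≤ v<i))) (Run-below r k (ℕ.≤-trans k≤v (ℕ.<⇒≤ v<i)))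

v<v+1+k : ∀ v k → v < v + suc k
v<v+1+k v k = ℕ.m<m+n v z<s

shift-index : v < i → ∀ k → ∃ λ k′ → k < k′ × v + suc k′ ≡ i + suc k
shift-index {v} v<i k with ℕ.m≤n⇒∃[o]m+o≡n v<i
... | o , refl = suc o + k , ℕ.m<n+m k z<s , (begin
  v + (suc (suc (o + k))) ≡⟨ cong (v +_) (sym (ℕ.+-suc (suc o) k)) ⟩
  v + (suc o + suc k)     ≡⟨ sym (ℕ.+-assoc v (suc o) (suc k)) ⟩
  v + suc o + suc k       ≡⟨ cong (_+ suc k) (ℕ.+-suc v o) ⟩
  suc v + o + suc k       ∎)
  where open ≡-Reasoning

-- `v + suc k` is the first value after the current and the next `k` blocks. Each index below it is
-- paid for by one unit of `Φ`, by `Φ-step`. A later value `i` reopens all positions, but leaves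
-- fewer blocks below the same threshold, and `Φ-jump` covers the difference.
bound : Run C v p as is → ∀ k → below (v + suc k) is ≤ Φ C p k
bound ([] _) k = z≤n
bound {v = v} {is = _ ∷ is} (same s a<p r) k =
  ℕ.≤-trans (ℕ.≤-reflexive (below-< is (v<v+1+k v k)))
    (ℕ.≤-trans (s≤s (bound r k)) (Φ-step s a<p k))
bound {C} {v} {p} {is = i ∷ is} (later {a = a} {C′} s v<i r) k with v + suc k ℕ.≤? i
... | yes ≤i = ℕ.≤-trans (ℕ.≤-reflexive (trans (below-≥ is ≤i) (Run-below r _ ≤i))) z≤n
... | no  ≰i with ℕ.m≤n⇒∃[o]m+o≡n (ℕ.≰⇒> ≰i)
...   | o , eq = subst (λ x → below x (i ∷ is) ≤ Φ C p k) (trans (ℕ.+-suc i o) eq) (begin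
  below (i + suc o) (i ∷ is) ≡⟨ below-< is (v<v+1+k i o) ⟩
  suc (below (i + suc o) is) ≤⟨ s≤s (bound r o) ⟩
  suc (Φ C′ a o)             ≤⟨ Φ-step s (ℕ.n<1+n a) o ⟩
  Φ C (suc a) o              ≤⟨ Φ-jump C (suc a) p o<k ⟩
  Φ C p k                    ∎)
  where
  open ℕ.≤-Reasoning
  o<k : o < k
  o<k = ℕ.+-cancelˡ-≤ v _ _ (s≤s⁻¹ (begin
    suc (v + suc o) ≤⟨ ℕ.+-monoˡ-≤ (suc o) v<i ⟩
    i + suc o       ≡⟨ trans (ℕ.+-suc i o) eq ⟩
    v + suc k       ≡⟨ ℕ.+-suc v k ⟩
    suc (v + k)     ∎))

record Tight (C : List ℕ) (v p : ℕ) (is : List ℕ) : Set where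
  constructor ⟨_⟩
  field meets : ∀ k → Φ C p k ≤ below (v + suc k) is

open Tight

tight-tail : C —[ a ]→ C′ → a < p → Tight C v p (v ∷ is) → Tight C′ v a is
tight-tail {v = v} {is = is} s a<p t .meets k = s≤s⁻¹ (ℕ.≤-trans (Φ-step s a<p k)
  (ℕ.≤-trans (t .meets k) (ℕ.≤-reflexive (below-< is (v<v+1+k v k)))))

-- Skipping ahead to `i` leaves fewer blocks before each threshold, and by `Φ-jump` one block fewer
-- outweighs any choice of open positions; hence `p′` is arbitrary.
tight-later : ∀ p′ → v < i → Tight C v p is → Tight C i p′ is
tight-later {v} {i} {C} {p} {is} p′ v<i t .meets k with shift-index v<i k
... | k′ , k<k′ , eq = ℕ.≤-trans (Φ-jump C p′ p k<k′) (subst (λ x → Φ C p k′ ≤ below x is) eq (t .meets k′))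

-- Only the current block counts at `k` = 0, and by `Φ-skip` passing over `a′` loses an entry that
-- no later letter of the block can make up. So a tight run always takes the greatest movable
-- position below `p`.
tight-letter : C —[ a ]→ C′ → C —[ a′ ]→ C″ → a′ < p → Run C′ v a as is → Tight C v p (v ∷ is) → ¬ a < a′
tight-letter {C} {a} {C′} {p = p} {v} {is = is} s s′ a′<p r t a<a′ = ℕ.<-irrefl refl (begin-strict
  Φ C p 0                  ≤⟨ t .meets 0 ⟩
  below (v + 1) (v ∷ is)   ≡⟨ below-< is (v<v+1+k v 0) ⟩
  suc (below (v + 1) is)   ≤⟨ s≤s (bound r 0) ⟩
  suc (Φ C′ a 0)           <⟨ Φ-skip s s′ a<a′ a′<p ⟩
  Φ C p 0                  ∎)
  where open ℕ.≤-Reasoning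

step-deterministic : C —[ a ]→ C′ → C —[ a ]→ C″ → C′ ≡ C″
step-deterministic (here _)  (here _)   = refl
step-deterministic (there s) (there s′) = cong (_ ∷_) (step-deterministic s s′)

run-unique : Run C v p as is → Run C v p as′ is → Tight C v p is → as ≡ as′

same-unique : C —[ a ]→ C′ → C —[ a′ ]→ C″ → a < p → a′ < p →
              Run C′ v a as is → Run C″ v a′ as′ is → Tight C v p (v ∷ is) →
              a ∷ as ≡ a′ ∷ as′
same-unique {a = a} {a′ = a′} s s′ a<p a′<p r r′ t with ℕ.<-cmp a a′
... | tri< a<a′ _ _ = contradiction a<a′ (tight-letter s s′ a′<p r t)
... | tri> _ _ a′<a = contradiction a′<a (tight-letter s′ s a<p r′ t)
... | tri≈ _ refl _ with step-deterministic s s′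
...   | refl = cong (a ∷_) (run-unique r r′ (tight-tail s a<p t))

run-unique ([] _) ([] _) t = refl
run-unique (same s a<p r) (same s′ a′<p r′) t = same-unique s s′ a<p a′<p r r′ t
run-unique (same _ _ _) (later _ v<v _) t = contradiction v<v (ℕ.<-irrefl refl)
run-unique (later _ v<v _) (same _ _ _) t = contradiction v<v (ℕ.<-irrefl refl)
run-unique (later {a = a} s v<i r) (later {a = a′} s′ _ r′) t =
  -- A new block sets no bound on its first letter; `suc (a ⊔ a′)` is a bound that admits both
  -- candidates.
  same-unique s s′ (s≤s (ℕ.m≤m⊔n a a′)) (s≤s (ℕ.m≤n⊔m a a′)) r r′ (tight-later (suc (a ⊔ a′)) v<i t)

-- Lehmer codes are bounded in this sense, which forces the last entry to be 0.
Bounded : List ℕ → Set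
Bounded []      = ⊤
Bounded (c ∷ C) = c ≤ length C × Bounded C

step-length : C —[ a ]→ C′ → length C ≡ length C′
step-length (here _)  = refl
step-length (there s) = cong suc (step-length s)

step-sum : C —[ a ]→ C′ → sum C ≡ suc (sum C′)
step-sum {suc c ∷ b ∷ C} (here _) = cong suc (swap-sum c b (sum C))
step-sum {c ∷ C} (there s) = trans (cong (c +_) (step-sum s)) (ℕ.+-suc c _)

step-bounded : C —[ a ]→ C′ → Bounded C → Bounded C′
step-bounded {suc c ∷ b ∷ C} (here _) (c< , b≤ , B) = ℕ.m≤n⇒m≤1+n b≤ , s≤s⁻¹ c< , B
step-bounded {c ∷ C} (there s) (c≤ , B) = subst (c ≤_) (step-length s) c≤ , step-bounded s B

step-letter : C —[ a ]→ C′ → suc a < length C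
step-letter (here _)  = s<s z<s
step-letter (there s) = s<s (step-letter s)

-- Existence of a tight run by greedy choice

data ZeroAt : ℕ → List ℕ → Set where
  here  : ZeroAt 0 (0 ∷ C)
  there : ZeroAt p C → ZeroAt (suc p) (c ∷ C)

data ZeroBelow : ℕ → List ℕ → Set where
  []  : ZeroBelow 0 C
  _∷_ : c ≡ 0 → ZeroBelow p C → ZeroBelow (suc p) (c ∷ C)

Φ-zero : ZeroBelow p C → ∀ k → Φ C p k ≤ Φ C 0 k
Φ-zero []         k = ℕ.≤-refl
Φ-zero (refl ∷ z) k = Φ-zero z k

-- The last position before p with a nonzero entry can be moved, the entry next
-- to it being zero.
last-movable : ∀ C p → ZeroAt p C →
  ZeroBelow p C ⊎
  ∃₂ λ a C′ → C —[ a ]→ C′ × a < p × ZeroAt a C′ × (∀ k → Φ C p k ≤ suc (Φ C′ a k))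
last-movable C       zero    z         = inj₁ []
last-movable (c ∷ C) (suc p) (there z) with last-movable C p z
... | inj₂ (a , C′ , s , a<p , z′ , t) = inj₂ (suc a , c ∷ C′ , there s , s≤s a<p , there z′ , λ k →
        ℕ.≤-trans (ℕ.+-monoʳ-≤ (c ⊓ suc k) (t k)) (ℕ.≤-reflexive (ℕ.+-suc (c ⊓ suc k) _)))
last-movable (zero ∷ C)      (suc p) (there z) | inj₁ zb = inj₁ (refl ∷ zb)
last-movable (suc c ∷ 0 ∷ C) (suc _) (there here) | inj₁ zb =
  inj₂ (0 , 0 ∷ c ∷ C , here z≤n , z<s , here , λ k → ℕ.≤-refl)
last-movable (suc c ∷ 0 ∷ C) (suc _) (there (there z)) | inj₁ (refl ∷ zb) =
  inj₂ (0 , 0 ∷ c ∷ C , here z≤n , z<s , here , λ k → s≤s (ℕ.+-monoʳ-≤ (c ⊓ k) (Φ-zero zb k)))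

all-zero : ZeroAt p C → ZeroBelow p C → suc p ≡ length C → All (_≡ 0) C
all-zero {C = 0 ∷ []} here [] refl = refl ∷ []
all-zero (there z) (c≡0 ∷ zb) eq = c≡0 ∷ all-zero z zb (ℕ.suc-injective eq)

zeroAt-last : ∀ c C → Bounded (c ∷ C) → ZeroAt (length C) (c ∷ C)
zeroAt-last .0 []       (z≤n , _) = here
zeroAt-last c  (c′ ∷ C) (_ , B)   = there (zeroAt-last c′ C B)

Φ-last : ZeroAt p C → suc p ≡ length C → ∀ k → ∑⊓ C (suc k) ≤ Φ C p k
Φ-last {C = 0 ∷ []} here      eq k = z≤n
Φ-last {C = c ∷ C}  (there z) eq k = ℕ.+-monoʳ-≤ (c ⊓ suc k) (Φ-last z (ℕ.suc-injective eq) k)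

Φ-zeros : All (_≡ 0) C → ∀ p k → Φ C p k ≡ 0
Φ-zeros []         p       k = refl
Φ-zeros (refl ∷ z) zero    k = Φ-zeros z zero k
Φ-zeros (refl ∷ z) (suc p) k = Φ-zeros z p k

TightRun : List ℕ → ℕ → ℕ → Set
TightRun C v p = ∃₂ λ as is → Run C v p as is × Tight C v p is

tight-head : (∀ k → Φ C p k ≤ suc (Φ C′ a k)) → Tight C′ v a is → Tight C v p (v ∷ is)
tight-head {v = v} {is = is} le t .meets k =
  ℕ.≤-trans (le k) (ℕ.≤-trans (s≤s (t .meets k)) (ℕ.≤-reflexive (sym (below-< is (v<v+1+k v k)))))

-- Greedy choice: move the last nonzero open entry, and pass to the value `suc v` when the open
-- entries are exhausted. The zero at position `p` ensures that this entry has a zero to its right,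
-- hence is movable, and the step leaves a zero at the new bound. `n` exceeds the sum of the code,
-- which each step lowers by one.
open-block : ∀ n C v p → sum C < n → Bounded C → ZeroAt p C → TightRun C v p
open-block (suc n) C v p (s≤s sum≤) B z with last-movable C p z
... | inj₂ (a , C′ , s , a<p , z′ , t)
    with open-block n C′ v a (subst (_≤ n) (step-sum s) sum≤) (step-bounded s B) z′
...   | as , is , r , t′ = a ∷ as , v ∷ is , same s a<p r , tight-head t t′
-- All open entries are zero. The next block starts from the last position, whose entry is zero by
-- boundedness; if nothing can be moved from there, the whole code is zero.
open-block (suc n) C@(c ∷ D) v p (s≤s sum≤) B z | inj₁ zb with last-movable C (length D) (zeroAt-last c D B)
... | inj₁ zb′ = [] , [] , [] zero′ , ⟨ (λ k → ℕ.≤-reflexive (Φ-zeros zero′ p k)) ⟩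
  where zero′ = all-zero (zeroAt-last c D B) zb′ refl
... | inj₂ (a , C′ , s , a<l , z′ , t)
    with open-block n C′ (suc v) a (subst (_≤ n) (step-sum s) sum≤) (step-bounded s B) z′
...   | as , is , r , t′ = a ∷ as , suc v ∷ is , later s (ℕ.n<1+n v) r , tight
  where
  open ℕ.≤-Reasoning
  tight : Tight C v p (suc v ∷ is)
  tight .meets zero    = begin
    Φ C p 0  ≤⟨ Φ-zero zb 0 ⟩
    Φ C 0 0  ≡⟨ trans (Φ-closed C 0) (∑⊓-zero C) ⟩
    0        ≤⟨ z≤n ⟩
    _        ∎
  tight .meets (suc k) = begin
    Φ C p (suc k)                         ≤⟨ Φ-zero zb (suc k) ⟩
    Φ C 0 (suc k)                         ≡⟨ Φ-closed C (suc k) ⟩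
    ∑⊓ C (suc k)                          ≤⟨ Φ-last (zeroAt-last c D B) refl k ⟩
    Φ C (length D) k                      ≤⟨ tight-head {C = C} {p = length D} t t′ .meets k ⟩
    below (suc v + suc k) (suc v ∷ is)    ≡⟨ cong (λ x → below x (suc v ∷ is)) (sym (ℕ.+-suc v (suc k))) ⟩
    below (v + suc (suc k)) (suc v ∷ is)  ∎

Run-weaken : p ≤ p′ → Run C v p as is → Run C v p′ as is
Run-weaken p≤ ([] z)          = [] z
Run-weaken p≤ (same s a<p r)  = same s (ℕ.≤-trans a<p p≤) r
Run-weaken p≤ (later s v<i r) = later s v<i r

run-bound : Run C 0 (length C) as is → ∀ k → below k is ≤ ∑⊓ C k
run-bound {C} r zero    = ℕ.≤-reflexive (trans (Run-below r 0 z≤n) (sym (∑⊓-zero C)))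
run-bound {C} r (suc k) = ℕ.≤-trans (bound r k) (ℕ.≤-reflexive (Φ-open C k))

run-exists : ∀ C → Bounded C → ∃₂ λ as is → Run C 0 (length C) as is × (∀ k → ∑⊓ C k ≤ below k is)
run-exists []      _ = [] , [] , [] [] , λ _ → z≤n
run-exists (c ∷ C) B with open-block _ (c ∷ C) 0 (length C) (ℕ.n<1+n _) B (zeroAt-last c C B)
... | as , is , r , t = as , is , Run-weaken (ℕ.n≤1+n _) r , λ where
  zero    → ℕ.≤-trans (ℕ.≤-reflexive (∑⊓-zero (c ∷ C))) z≤n
  (suc k) → ℕ.≤-trans (Φ-last (zeroAt-last c C B) refl k) (t .meets k)

run-unique₀ : Run C 0 (length C) as is → Run C 0 (length C) as′ is →
              (∀ k → ∑⊓ C k ≤ below k is) → as ≡ as′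
run-unique₀ {C} r r′ t = run-unique r r′ ⟨ (λ k → ℕ.≤-trans (ℕ.≤-reflexive (Φ-open C k)) (t (suc k))) ⟩

-- Lehmer codes

code : List ℕ → List ℕ
code []       = []
code (x ∷ xs) = below x xs ∷ code xs

length-code : ∀ xs → length (code xs) ≡ length xs
length-code []       = refl
length-code (x ∷ xs) = cong suc (length-code xs)

code-bounded : ∀ xs → Bounded (code xs)
code-bounded []       = tt
code-bounded (x ∷ xs) =
  ℕ.≤-trans (length-filter (ℕ._<? x) xs) (ℕ.≤-reflexive (sym (length-code xs))) , code-bounded xs

swapAt : ℕ → List A → List A
swapAt zero    (x ∷ y ∷ xs) = y ∷ x ∷ xs
swapAt (suc a) (x ∷ xs)     = x ∷ swapAt a xs
swapAt _       xs           = xs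

swapAt-↭ : ∀ a (xs : List A) → swapAt a xs ↭ xs
swapAt-↭ zero    []           = ↭-refl
swapAt-↭ zero    (x ∷ [])     = ↭-refl
swapAt-↭ zero    (x ∷ y ∷ xs) = swap y x ↭-refl
swapAt-↭ (suc a) []           = ↭-refl
swapAt-↭ (suc a) (x ∷ xs)     = prep x (swapAt-↭ a xs)

unique-↭ : ∀ {xs ys : List A} → xs ↭ ys → Unique xs → Unique ys
unique-↭ p = Permₛ.Unique-resp-↭ (setoid _) (↭⇒↭ₛ p)

below-↭ : ∀ k {xs ys} → xs ↭ ys → below k xs ≡ below k ys
below-↭ k p = ↭-length (filter-↭ (ℕ._<? k) p)

below-mono : ∀ {k k′} → k ≤ k′ → ∀ xs → below k xs ≤ below k′ xs
below-mono k≤ [] = z≤n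
below-mono {k} {k′} k≤ (x ∷ xs) with x ℕ.<? k
... | yes x<k rewrite below-< xs x<k | below-< xs (ℕ.<-≤-trans x<k k≤) = s≤s (below-mono k≤ xs)
... | no  x≮k rewrite below-≥ xs (ℕ.≮⇒≥ x≮k) with x ℕ.<? k′
...   | yes x<k′ rewrite below-< xs x<k′ = ℕ.m≤n⇒m≤1+n (below-mono k≤ xs)
...   | no  x≮k′ rewrite below-≥ xs (ℕ.≮⇒≥ x≮k′) = below-mono k≤ xs

-- Entries left of position `a` keep the same set to their right, and those right of a+1 are
-- unaffected. At a descent `x`, `y` the larger entry loses its inversion with `y`, and the
-- condition of `here` is the monotonicity of `below`.
code-swap : ∀ a xs → Unique xs →
  code xs —[ a ]→ code (swapAt a xs) ⊎ code (swapAt a xs) —[ a ]→ code xs ⊎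
  (length xs ≤ suc a × swapAt a xs ≡ xs)
code-swap zero    []       u = inj₂ (inj₂ (z≤n , refl))
code-swap zero    (x ∷ []) u = inj₂ (inj₂ (s≤s z≤n , refl))
code-swap zero    (x ∷ y ∷ xs) ((x≢y ∷ _) ∷ _) with ℕ.<-cmp x y
... | tri< x<y _ _ rewrite below-< xs x<y | below-≥ xs (ℕ.<⇒≤ x<y) =
    inj₂ (inj₁ (here (below-mono (ℕ.<⇒≤ x<y) xs)))
... | tri≈ _ x≡y _ = contradiction x≡y x≢y
... | tri> _ _ y<x rewrite below-< xs y<x | below-≥ xs (ℕ.<⇒≤ y<x) = inj₁ (here (below-mono (ℕ.<⇒≤ y<x) xs))
code-swap (suc a) []       u = inj₂ (inj₂ (z≤n , refl))
code-swap (suc a) (x ∷ xs) (_ ∷ u) rewrite below-↭ x (swapAt-↭ a xs) with code-swap a xs u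
... | inj₁ s               = inj₁ (there s)
... | inj₂ (inj₁ s)        = inj₂ (inj₁ (there s))
... | inj₂ (inj₂ (l , eq)) = inj₂ (inj₂ (s≤s l , cong (x ∷_) eq))

act : List ℕ → List A → List A
act []       xs = xs
act (a ∷ as) xs = act as (swapAt a xs)

swap-unique : ∀ a {xs : List A} → Unique xs → Unique (swapAt a xs)
swap-unique a = unique-↭ (↭-sym (swapAt-↭ a _))

sum-zero : ∀ {C} → All (_≡ 0) C → sum C ≡ 0
sum-zero []         = refl
sum-zero (refl ∷ z) = sum-zero z

code-sum-≤ : ∀ as xs → Unique xs → All (_≡ 0) (code (act as xs)) → sum (code xs) ≤ length as
code-sum-≤ []       xs u z = ℕ.≤-reflexive (sum-zero z)
code-sum-≤ (a ∷ as) xs u z with code-sum-≤ as (swapAt a xs) (swap-unique a u) z | code-swap a xs u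
... | ih | inj₁ s                = subst (_≤ suc (length as)) (sym (step-sum s)) (s≤s ih)
... | ih | inj₂ (inj₁ s)         =
    ℕ.≤-trans (ℕ.n≤1+n _) (ℕ.≤-trans (subst (_≤ length as) (step-sum s) ih) (ℕ.n≤1+n _))
... | ih | inj₂ (inj₂ (_ , eq))  = ℕ.m≤n⇒m≤1+n (subst (λ x → sum (code x) ≤ length as) eq ih)

-- The sum of a code is the number of inversions, which a letter lowers by at most one. A sorting
-- word no longer than that number cannot afford a letter that creates an inversion or changes
-- nothing.
shortest⇒path : ∀ as xs → Unique xs → All (_≡ 0) (code (act as xs)) → length as ≤ sum (code xs) →
    Path (code xs) as
shortest⇒path []       xs u z le = [] z
shortest⇒path (a ∷ as) xs u z le
  with code-sum-≤ as (swapAt a xs) (swap-unique a u) z | code-swap a xs u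
... | ih | inj₁ s               = s ∷ shortest⇒path as (swapAt a xs) (swap-unique a u) z
    (s≤s⁻¹ (subst (suc (length as) ≤_) (step-sum s) le))
... | ih | inj₂ (inj₁ s)        =
    contradiction (ℕ.≤-trans le (ℕ.≤-trans (ℕ.n≤1+n _) (subst (_≤ length as) (step-sum s) ih)))
    (ℕ.<-irrefl refl)
... | ih | inj₂ (inj₂ (_ , eq)) = contradiction (ℕ.≤-trans le (subst (λ x → sum (code x) ≤ length as) eq ih))
    (ℕ.<-irrefl refl)

step-twice : ∀ {C C′ C″} → C —[ a ]→ C′ → ¬ C′ —[ a ]→ C″
step-twice (here b≤c)  (here c≤b) = ℕ.<-irrefl refl (ℕ.≤-trans b≤c c≤b)
step-twice (there s)   (there s′) = step-twice s s′

path⇒zero : ∀ {as} xs → Unique xs → Path (code xs) as → All (_≡ 0) (code (act as xs))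
path⇒zero xs u ([] z) = z
path⇒zero {a ∷ as} xs u (s ∷ p) with code-swap a xs u
... | inj₁ s′ rewrite step-deterministic s s′ = path⇒zero (swapAt a xs) (swap-unique a u) p
... | inj₂ (inj₁ s′)       = contradiction s (step-twice s′)
... | inj₂ (inj₂ (l , _))  =
    contradiction (ℕ.≤-trans (step-letter s) (ℕ.≤-trans (ℕ.≤-reflexive (length-code xs)) l)) (ℕ.<-irrefl refl)

path-length : ∀ {C as} → Path C as → length as ≡ sum C
path-length ([] z)  = sym (sum-zero z)
path-length (s ∷ p) = trans (cong suc (path-length p)) (sym (step-sum s))

path-letters : ∀ {C as} → Path C as → All (λ a → suc a < length C) as
path-letters ([] z)  = []
path-letters (s ∷ p) = step-letter s ∷ subst (λ l → All (λ a → suc a < l) _) (sym (step-length s))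
    (path-letters p)

-- Reduced words as paths of codes

numbers : Vec (Fin m) d → List ℕ
numbers a = toList (Vec.map toℕ a)

length-numbers : (a : Vec (Fin m) d) → length (numbers a) ≡ d
length-numbers []      = refl
length-numbers (x ∷ a) = cong suc (length-numbers a)

numbers-injective : ∀ {a b : Vec (Fin m) d} → numbers a ≡ numbers b → a ≡ b
numbers-injective {a = []}    {[]}    eq = refl
numbers-injective {a = x ∷ a} {y ∷ b} eq with ∷-injective eq
... | x≡y , eq′ = cong₂ _∷_ (toℕ-injective x≡y) (numbers-injective eq′)

fromNumbers : ∀ l → length l ≡ d → All (_< m) l → ∃ λ (a : Vec (Fin m) d) → numbers a ≡ l
fromNumbers []      refl []       = [] , refl
fromNumbers (x ∷ l) refl (x< ∷ l<) with fromNumbers l refl l<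
... | a , eq = fromℕ< x< ∷ a , cong₂ _∷_ (toℕ-fromℕ< x<) eq

transpose-suc : ∀ (i j k : Fin n) → PC.transpose (suc i) (suc j) (suc k) ≡ suc (PC.transpose i j k)
transpose-suc i j k with does (k Fin.≟ i)
... | true  = refl
... | false with does (k Fin.≟ j)
...   | true  = refl
...   | false = refl

swapAt-tabulate : ∀ (f : Fin n → A) (a : Fin (pred n)) →
  swapAt (toℕ a) (List.tabulate f) ≡ List.tabulate (λ i → f (s a ⟨$⟩ʳ i))
swapAt-tabulate {suc (suc n)} f zero    = refl
swapAt-tabulate {suc (suc n)} f (suc a) = cong (f zero ∷_) (trans (swapAt-tabulate (f ∘ suc) a)
  (tabulate-cong λ i → cong f (sym (transpose-suc (inject₁ a) (suc a) i))))

act-tabulate : ∀ (f : Fin n → A) (a : Vec (Fin (pred n)) d) →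
  act (numbers a) (List.tabulate f) ≡ List.tabulate (λ i → f (product a ⟨$⟩ʳ i))
act-tabulate f []      = refl
act-tabulate f (i ∷ a) = trans (cong (act (numbers a)) (swapAt-tabulate f i))
    (act-tabulate (λ j → f (s i ⟨$⟩ʳ j)) a)

-- Letters act on positions, that is by multiplication from the right, so a word `a` sorts the
-- one-line notation of w⁻¹ exactly when w⁻¹ times `product a` is the identity.
oneLine : Permutation′ n → List ℕ
oneLine w = List.tabulate (λ i → toℕ (w ⟨$⟩ˡ i))

permCode : Permutation′ n → List ℕ
permCode w = code (oneLine w)

length-permCode : (w : Permutation′ n) → length (permCode w) ≡ n
length-permCode w = trans (length-code (oneLine w)) (length-tabulate (λ i → toℕ (w ⟨$⟩ˡ i)))

injective-from : (w : Permutation′ n) → ∀ {i j} → w ⟨$⟩ˡ i ≡ w ⟨$⟩ˡ j → i ≡ j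
injective-from w eq = trans (sym (inverseʳ w)) (trans (cong (w ⟨$⟩ʳ_) eq) (inverseʳ w))

injective-to : (w : Permutation′ n) → ∀ {i j} → w ⟨$⟩ʳ i ≡ w ⟨$⟩ʳ j → i ≡ j
injective-to w eq = trans (sym (inverseˡ w)) (trans (cong (w ⟨$⟩ˡ_) eq) (inverseˡ w))

oneLine-unique : (w : Permutation′ n) → Unique (oneLine w)
oneLine-unique w = Unique.tabulate⁺ (injective-from w ∘ toℕ-injective)

tabulate-injective : ∀ {f g : Fin n → A} → List.tabulate f ≡ List.tabulate g → ∀ i → f i ≡ g i
tabulate-injective eq zero    = proj₁ (∷-injective eq)
tabulate-injective eq (suc i) = tabulate-injective (∷-injectiveʳ eq) i

below-none : ∀ {k xs} → All (k ≤_) xs → below k xs ≡ 0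
below-none {k} ≥k = cong length (filter-none (ℕ._<? k) (All.map ℕ.≤⇒≯ ≥k))

below-zero : ∀ k xs → below k xs ≡ 0 → All (k ≤_) xs
below-zero k []       _  = []
below-zero k (x ∷ xs) eq with x ℕ.<? k
... | yes x<k = contradiction (trans (sym (below-< xs x<k)) eq) λ ()
... | no  x≮k = ℕ.≮⇒≥ x≮k ∷ below-zero k xs (trans (sym (below-≥ xs (ℕ.≮⇒≥ x≮k))) eq)

sorted⇒zero : ∀ {xs} → AllPairs _≤_ xs → All (_≡ 0) (code xs)
sorted⇒zero []       = []
sorted⇒zero (p ∷ ps) = below-none p ∷ sorted⇒zero ps

zero⇒sorted : ∀ xs → All (_≡ 0) (code xs) → AllPairs _≤_ xs
zero⇒sorted []       []      = []
zero⇒sorted (x ∷ xs) (z ∷ zs) = below-zero x xs z ∷ zero⇒sorted xs zs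

increasing : ∀ n → AllPairs _≤_ (List.tabulate (toℕ {n}))
increasing n = AllPairs.tabulate⁺-< ℕ.<⇒≤

tabulate-↭ : (π : Permutation′ n) (f : Fin n → ℕ) → (∀ {i j} → f i ≡ f j → i ≡ j) →
             List.tabulate (λ i → f (π ⟨$⟩ʳ i)) ↭ List.tabulate f
tabulate-↭ π f inj = ∼bag⇒↭ (unique∧set⇒bag
  (Unique.tabulate⁺ (λ eq → injective-to π (inj eq))) (Unique.tabulate⁺ inj)
  (mk⇔ (λ x∈ → let i , eq = ∈-tabulate⁻ x∈ in subst (λ x → x ∈ List.tabulate f) (sym eq) (∈-tabulate⁺ (π ⟨$⟩ʳ i)))
       (λ x∈ → let i , eq = ∈-tabulate⁻ x∈ in
          subst (λ x → x ∈ List.tabulate (λ i → f (π ⟨$⟩ʳ i))) (trans (cong f (inverseʳ π)) (sym eq))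
              (∈-tabulate⁺ (π ⟨$⟩ˡ i)))))

module _ (w : Permutation′ n) (a : Vec (Fin (pred n)) d) where
  act-oneLine : act (numbers a) (oneLine w) ≡ List.tabulate (λ i → toℕ (w ⟨$⟩ˡ (product a ⟨$⟩ʳ i)))
  act-oneLine = act-tabulate _ a

  product⇒zero : product a ≈ w → All (_≡ 0) (code (act (numbers a) (oneLine w)))
  product⇒zero eq = sorted⇒zero (subst (AllPairs _≤_)
    (sym (trans act-oneLine (tabulate-cong λ i → cong toℕ (trans (cong (w ⟨$⟩ˡ_) (eq i)) (inverseˡ w)))))
        (increasing n))

  -- A zero code means a nondecreasing list, and the only nondecreasing rearrangement of 0, ..., n-1
  -- is the identity.
  zero⇒product : All (_≡ 0) (code (act (numbers a) (oneLine w))) → product a ≈ w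
  zero⇒product z i = trans (sym (inverseʳ w)) (cong (w ⟨$⟩ʳ_) (toℕ-injective (tabulate-injective eq i)))
    where
    σ = product a ∘ₚ Permutation.flip w
    eq : List.tabulate (λ i → toℕ (w ⟨$⟩ˡ (product a ⟨$⟩ʳ i))) ≡ List.tabulate toℕ
    eq = Pointwise-≡⇒≡ (↗↭↗⇒≋ ℕ.≤-totalOrder
      (Linked.AllPairs⇒Linked (subst (AllPairs _≤_) act-oneLine (zero⇒sorted _ z)))
      (Linked.AllPairs⇒Linked (increasing n)) (↭⇒↭ₛ (tabulate-↭ σ toℕ toℕ-injective)))

  path⇒product : Path (permCode w) (numbers a) → product a ≈ w
  path⇒product p = zero⇒product (path⇒zero (oneLine w) (oneLine-unique w) p)

  sum-code-≤ : product a ≈ w → sum (permCode w) ≤ d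
  sum-code-≤ eq = subst (sum (permCode w) ≤_) (length-numbers a)
      (code-sum-≤ (numbers a) (oneLine w) (oneLine-unique w) (product⇒zero eq))

path⇒reduced : (w : Permutation′ n) (a : Vec (Fin (pred n)) d) → Path (permCode w) (numbers a) → Reduced w a
path⇒reduced w a p = path⇒product w a p , λ b eq →
  ℕ.≤-trans (ℕ.≤-reflexive (trans (sym (length-numbers a)) (path-length p))) (sum-code-≤ w b eq)

run⇒path : ∀ {C v p as is} → Run C v p as is → Path C as
run⇒path ([] z)        = [] z
run⇒path (same s _ r)  = s ∷ run⇒path r
run⇒path (later s _ r) = s ∷ run⇒path r

run-length : ∀ {C v p as is} → Run C v p as is → length is ≡ length as
run-length ([] z)        = refl
run-length (same s _ r)  = cong suc (run-length r)
run-length (later s _ r) = cong suc (run-length r)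

path-word : (w : Permutation′ n) → ∀ {as} → Path (permCode w) as →
            ∃₂ λ d (a : Vec (Fin (pred n)) d) → numbers a ≡ as
path-word w {as} p = length as , fromNumbers as refl
    (All.map (λ a< → ℕ.pred-mono-≤ (ℕ.≤-trans a< (ℕ.≤-reflexive (length-permCode w)))) (path-letters p))

-- Minimality compares `a` with other words, so a word of length `sum (permCode w)` has to be
-- exhibited before `shortest⇒path` applies; the greedy run supplies one.
reduced⇒path : (w : Permutation′ n) (a : Vec (Fin (pred n)) d) → Reduced w a → Path (permCode w) (numbers a)
reduced⇒path {d = d} w a (eq , min) with run-exists (permCode w) (code-bounded (oneLine w))
... | as , is , r , _ with path-word w (run⇒path r)
...   | _ , b , refl = shortest⇒path (numbers a) (oneLine w) (oneLine-unique w) (product⇒zero w a eq)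
  (ℕ.≤-trans (ℕ.≤-reflexive (length-numbers a)) (ℕ.≤-trans (min b (path⇒product w b (run⇒path r)))
      (ℕ.≤-reflexive (trans (sym (length-numbers b)) (path-length (run⇒path r))))))

-- The extreme contents

-- Strict at equal neighbours too. Reduced words have none, by `step-twice`, so that this agrees
-- with `Step` on them; reversing the alphabet turns it into `Step′`.
StrictStep : Fin m × Fin K → Fin m × Fin K → Set
StrictStep (a , i) (a′ , i′) = i Fin.≤ i′ × (a Fin.≤ a′ → i Fin.< i′)

-- Strict exactly where there is no ascent. Equal letters belong here: lattice words may repeat a
-- letter, and complementing the ascent sets puts the repetitions on this side.
Step′ : Fin m × Fin K → Fin m × Fin K → Set
Step′ (a , i) (a′ , i′) = i Fin.≤ i′ × (a′ Fin.≤ a → i Fin.< i′)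

pairs : ∀ {A B : Set} → Vec A d → Vec B d → List (A × B)
pairs a is = toList (Vec.zip a is)

Compatible′ : Vec (Fin m) d → Vec (Fin K) d → Set
Compatible′ a is = Linked Step′ (pairs a is)

compatible⇒strict : ∀ {C} (a : Vec (Fin m) d) (is : Vec (Fin K) d) → Path C (numbers a) →
                    Compatible a is → Linked StrictStep (pairs a is)
compatible⇒strict []          []            _           _       = []
compatible⇒strict (a ∷ [])    (i ∷ [])      _           _       = [-]
compatible⇒strict (a ∷ b ∷ as) (i ∷ j ∷ is) (s ∷ s′ ∷ p) ((i≤j , lt) ∷ c) =
  (i≤j , λ a≤b → lt (ℕ.≤∧≢⇒< a≤b λ a≡b → step-twice s (subst (_ —[_]→ _) (sym a≡b) s′)))
  ∷ compatible⇒strict (b ∷ as) (j ∷ is) (s′ ∷ p) c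

strict⇒compatible : ∀ (a : Vec (Fin m) d) (is : Vec (Fin K) d) → Linked StrictStep (pairs a is) →
    Compatible a is
strict⇒compatible _ _ = Linked.map λ (i≤ , lt) → i≤ , λ a< → lt (ℕ.<⇒≤ a<)

strict⇒run : ∀ {C} (a : Vec (Fin m) d) (is : Vec (Fin K) d) → Path C (numbers a) →
             Linked StrictStep (pairs a is) → Run C 0 (length C) (numbers a) (numbers is)
strict⇒run []      []      ([] z)  _ = [] z
strict⇒run {K = K} (a ∷ as) (i ∷ is) (s ∷ p) l = start i s (go a i as is p l)
  where
  go : ∀ {C d} a (i : Fin K) (as : Vec (Fin _) d) (is : Vec (Fin K) d) → Path C (numbers as) →
       Linked StrictStep (pairs (a ∷ as) (i ∷ is)) → Run C (toℕ i) (toℕ a) (numbers as) (numbers is)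
  go a i []       []       ([] z)  _                = [] z
  go a i (b ∷ as) (j ∷ is) (s ∷ p) ((i≤j , lt) ∷ l) with toℕ i ℕ.≟ toℕ j
  ... | no  i≢j = later s (ℕ.≤∧≢⇒< i≤j i≢j) (go b j as is p l)
  ... | yes i≡j with toℕ b ℕ.<? toℕ a
  ...   | yes b<a rewrite i≡j = same s b<a (go b j as is p l)
  ...   | no  b≮a = contradiction i≡j (ℕ.<⇒≢ (lt (ℕ.≮⇒≥ b≮a)))
  start : ∀ {C C′ a as is} (i : Fin K) → C —[ a ]→ C′ → Run C′ (toℕ i) a as is →
      Run C 0 (length C) (a ∷ as) (toℕ i ∷ is)
  -- An initial index 0 belongs to the block that is already current, in which every position is
  -- open; any other index starts a later block.
  start zero    s r = same s (ℕ.<-trans (ℕ.n<1+n _) (step-letter s)) r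
  start (suc i) s r = later s z<s r

run-head : ∀ {C v p a as i is} → Run C v p (a ∷ as) (i ∷ is) → v ≤ i × (p ≤ a → v < i)
run-head (same _ a<p _)  = ℕ.≤-refl , λ p≤a → contradiction a<p (ℕ.≤⇒≯ p≤a)
run-head (later _ v<i _) = ℕ.<⇒≤ v<i , λ _ → v<i

run-tail : ∀ {C v p a as i is} → Run C v p (a ∷ as) (i ∷ is) → ∃ λ C′ → Run C′ i a as is
run-tail (same _ _ r)  = -, r
run-tail (later _ _ r) = -, r

run⇒strict : ∀ {C v p} (a : Vec (Fin m) d) (is : Vec (Fin K) d) →
             Run C v p (numbers a) (numbers is) → Linked StrictStep (pairs a is)
run⇒strict []           []           _ = []
run⇒strict (a ∷ [])     (i ∷ [])     _ = [-]
run⇒strict (a ∷ b ∷ as) (i ∷ j ∷ is) r = run-head (proj₂ (run-tail r)) ∷ run⇒strict (b ∷ as) (j ∷ is)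
    (proj₂ (run-tail r))

-- With the relation R in the role of compatibility, the contents are dominated by
-- a content which occurs exactly once.
record Dominated (w : Permutation′ n)
                 (R : ∀ {d K} → Vec (Fin (pred n)) d → Vec (Fin K) d → Set) : Set where
  field
    top      : ℕ → ℕ
    dominate : ∀ {d K} (a : Vec _ d) (is : Vec (Fin K) d) → Reduced w a → R a is → ∀ k →
        below k (numbers is) ≤ top k
    {size vars} : ℕ
    word     : Vec (Fin (pred n)) size
    indices  : Vec (Fin vars) size
    reduced  : Reduced w word
    related  : R word indices
    attain   : ∀ k → top k ≤ below k (numbers indices)
    only     : ∀ a → Reduced w a → R a indices → a ≡ word

bounded-above : ∀ l → ∃ λ K → All (_< K) l
bounded-above []      = 0 , []
bounded-above (x ∷ l) with bounded-above l
... | K , l< = suc x ⊔ K , ℕ.m≤m⊔n (suc x) K ∷ All.map (λ y< → ℕ.<-≤-trans y< (ℕ.m≤n⊔m (suc x) K)) l<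

strict-dominated : (w : Permutation′ n) → Dominated w λ a is → Linked StrictStep (pairs a is)
strict-dominated {n} w with run-exists (permCode w) (code-bounded (oneLine w))
... | as , is , r , t with path-word w (run⇒path r) | bounded-above is
...   | _ , a , refl | _ , is< with fromNumbers is (trans (run-length r) (length-numbers a)) is<
...     | i , refl = record
  { top      = ∑⊓ (permCode w)
  ; dominate = λ b j rb c → run-bound (strict⇒run b j (reduced⇒path w b rb) c)
  ; word     = a
  ; indices  = i
  ; reduced  = path⇒reduced w a (run⇒path r)
  ; related  = run⇒strict a i r
  ; attain   = t
  ; only     = λ b rb c → numbers-injective (run-unique₀ (strict⇒run b i (reduced⇒path w b rb) c) r t)
  }

compatible-dominated : (w : Permutation′ n) → Dominated w Compatible
compatible-dominated w = record
  { D
  ; dominate = λ a is ra c → D.dominate a is ra (compatible⇒strict a is (reduced⇒path w a ra) c)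
  ; related  = strict⇒compatible D.word D.indices D.related
  ; only     = λ a ra c → D.only a ra (compatible⇒strict a D.indices (reduced⇒path w a ra) c)
  }
  where module D = Dominated (strict-dominated w)

-- Conjugation by the longest permutation

conjugate : Permutation′ n → Permutation′ n
conjugate w = reverse ∘ₚ w ∘ₚ reverse

opposite-injective : ∀ {i j : Fin n} → opposite i ≡ opposite j → i ≡ j
opposite-injective {i = i} {j} eq =
    trans (sym (opposite-involutive i)) (trans (cong opposite eq) (opposite-involutive j))

transpose-first : ∀ (i j : Fin n) → PC.transpose i j i ≡ j
transpose-first i j rewrite dec-true (i Fin.≟ i) refl = refl

transpose-other : ∀ {i j k : Fin n} → k ≢ i → k ≢ j → PC.transpose i j k ≡ k
transpose-other {i = i} {j} {k} k≢i k≢j rewrite dec-false (k Fin.≟ i) k≢i | dec-false (k Fin.≟ j) k≢j = refl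

transpose-second : ∀ (i j : Fin n) → PC.transpose i j j ≡ i
transpose-second i j with j Fin.≟ i
... | yes j≡i = j≡i
... | no  _ rewrite dec-true (j Fin.≟ j) refl = refl

transpose-opposite : ∀ (i j k : Fin n) → PC.transpose (opposite j) (opposite i) (opposite k) ≡ opposite
    (PC.transpose i j k)
transpose-opposite i j k with k Fin.≟ i
... | yes refl = transpose-second (opposite j) (opposite k)
... | no k≢i with k Fin.≟ j
...   | yes refl = transpose-first (opposite k) (opposite i)
...   | no k≢j = transpose-other (k≢j ∘ opposite-injective) (k≢i ∘ opposite-injective)

opposite-inject₁ : (i : Fin n) → opposite (inject₁ i) ≡ suc (opposite i)
opposite-inject₁ i = opposite-injective (trans (opposite-involutive (inject₁ i))
    (cong inject₁ (sym (opposite-involutive i))))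

s-opposite : ∀ (i : Fin (pred n)) (j : Fin n) → s (opposite i) ⟨$⟩ʳ opposite j ≡ opposite (s i ⟨$⟩ʳ j)
s-opposite {suc n} i j = trans
  (cong (λ x → PC.transpose (inject₁ (opposite i)) x (opposite j)) (sym (opposite-inject₁ i)))
  (transpose-opposite (inject₁ i) (suc i) j)

product-opposite : ∀ (a : Vec (Fin (pred n)) d) (j : Fin n) →
  product (Vec.map opposite a) ⟨$⟩ʳ opposite j ≡ opposite (product a ⟨$⟩ʳ j)
product-opposite []      j = refl
product-opposite {n} (i ∷ a) j = trans (cong (s {n} (opposite i) ⟨$⟩ʳ_) (product-opposite a j))
    (s-opposite i (product a ⟨$⟩ʳ j))

product-conjugate : ∀ (w : Permutation′ n) (a : Vec _ d) → product a ≈ w →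
    product (Vec.map opposite a) ≈ conjugate w
product-conjugate w a eq j = begin
  product (Vec.map opposite a) ⟨$⟩ʳ j
    ≡⟨ cong (product (Vec.map opposite a) ⟨$⟩ʳ_) (sym (opposite-involutive j)) ⟩
  product (Vec.map opposite a) ⟨$⟩ʳ opposite (opposite j) ≡⟨ product-opposite a (opposite j) ⟩
  opposite (product a ⟨$⟩ʳ opposite j)                    ≡⟨ cong opposite (eq (opposite j)) ⟩
  opposite (w ⟨$⟩ʳ opposite j)                            ∎
  where open ≡-Reasoning

product-conjugate⁻ : ∀ (w : Permutation′ n) (a : Vec _ d) → product a ≈ conjugate w →
    product (Vec.map opposite a) ≈ w
product-conjugate⁻ w a eq j = trans (product-conjugate (conjugate w) a eq j)
  (trans (opposite-involutive _) (cong (w ⟨$⟩ʳ_) (opposite-involutive j)))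

reduced-conjugate : ∀ (w : Permutation′ n) (a : Vec _ d) → Reduced w a →
    Reduced (conjugate w) (Vec.map opposite a)
reduced-conjugate w a (eq , min) = product-conjugate w a eq , λ b eqb →
    min (Vec.map opposite b) (product-conjugate⁻ w b eqb)

reduced-conjugate⁻ : ∀ (w : Permutation′ n) (a : Vec _ d) → Reduced (conjugate w) a →
    Reduced w (Vec.map opposite a)
reduced-conjugate⁻ w a (eq , min) = product-conjugate⁻ w a eq , λ b eqb →
    min (Vec.map opposite b) (product-conjugate w b eqb)

opposite-≤ : ∀ {i j : Fin n} → i Fin.≤ j → opposite j Fin.≤ opposite i
opposite-≤ {n} {i} {j} i≤j = subst₂ _≤_ (sym (opposite-prop j)) (sym (opposite-prop i))
    (ℕ.∸-monoʳ-≤ n (s≤s i≤j))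

opposite-≤⁻ : ∀ {i j : Fin n} → opposite i Fin.≤ opposite j → j Fin.≤ i
opposite-≤⁻ {i = i} {j} le = subst₂ Fin._≤_ (opposite-involutive j) (opposite-involutive i) (opposite-≤ le)

strict-opposite : ∀ (a : Vec (Fin m) d) (is : Vec (Fin K) d) → Compatible′ a is →
    Linked StrictStep (pairs (Vec.map opposite a) is)
strict-opposite []           []           _             = []
strict-opposite (a ∷ [])     (i ∷ [])     _             = [-]
strict-opposite (a ∷ b ∷ as) (i ∷ j ∷ is) ((i≤ , lt) ∷ c) = (i≤ , λ le → lt (opposite-≤⁻ le)) ∷ strict-opposite
    (b ∷ as) (j ∷ is) c

opposite-strict : ∀ (a : Vec (Fin m) d) (is : Vec (Fin K) d) → Linked StrictStep (pairs a is) →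
    Compatible′ (Vec.map opposite a) is
opposite-strict []           []           _             = []
opposite-strict (a ∷ [])     (i ∷ [])     _             = [-]
opposite-strict (a ∷ b ∷ as) (i ∷ j ∷ is) ((i≤ , lt) ∷ c) = (i≤ , λ le → lt (opposite-≤⁻ le)) ∷ opposite-strict
    (b ∷ as) (j ∷ is) c

map-opposite-involutive : (a : Vec (Fin m) d) → Vec.map opposite (Vec.map opposite a) ≡ a
map-opposite-involutive []      = refl
map-opposite-involutive (x ∷ a) = cong₂ _∷_ (opposite-involutive x) (map-opposite-involutive a)

-- Applying `opposite` to the letters is a bijection between the reduced words of `w` and those of
-- its conjugate. It reverses the order of the letters and keeps the indices, so it carries
-- `Compatible′` to `StrictStep` without changing any content.
compatible′-dominated : (w : Permutation′ n) → Dominated w Compatible′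
compatible′-dominated w = record
  { D
  ; dominate = λ a is ra c → D.dominate (Vec.map opposite a) is (reduced-conjugate w a ra)
      (strict-opposite a is c)
  ; word     = Vec.map opposite D.word
  ; reduced  = reduced-conjugate⁻ w D.word D.reduced
  ; related  = opposite-strict D.word D.indices D.related
  ; only     = λ a ra c → trans (sym (map-opposite-involutive a)) (cong (Vec.map opposite)
                 (D.only (Vec.map opposite a) (reduced-conjugate w a ra) (strict-opposite a D.indices c)))
  }
  where module D = Dominated (strict-dominated (conjugate w))

-- Counting words by their ascents

count : {P : Pred A 0ℓ} → Decidable P → List A → ℕ
count P? xs = length (filter P? xs)

count-yes : (P? : Decidable P) → ∀ {x} xs → P x → count P? (x ∷ xs) ≡ suc (count P? xs)
count-yes P? xs px = cong length (filter-accept P? px)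

count-no : (P? : Decidable P) → ∀ {x} xs → ¬ P x → count P? (x ∷ xs) ≡ count P? xs
count-no P? xs ¬px = cong length (filter-reject P? ¬px)

count-map : (P? : Decidable P) (Q? : Decidable Q) (f : A → B) → ∀ xs →
            (∀ x → P x → Q (f x)) → (∀ x → Q (f x) → P x) → count P? xs ≡ count Q? (map f xs)
count-map P? Q? f []       to from = refl
count-map P? Q? f (x ∷ xs) to from with P? x
... | yes px = trans (cong suc (count-map P? Q? f xs to from)) (sym (count-yes Q? (map f xs) (to x px)))
... | no ¬px = trans (count-map P? Q? f xs to from) (sym (count-no Q? (map f xs) (¬px ∘ from x)))

count-++ : (P? : Decidable P) → ∀ xs ys → count P? (xs ++ ys) ≡ count P? xs + count P? ys
count-++ P? xs ys = trans (cong length (filter-++ P? xs ys)) (length-++ (filter P? xs))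

count-replicate : (P? : Decidable P) → ∀ c xs → count P? (concat (replicate c xs)) ≡ c * count P? xs
count-replicate P? zero    xs = refl
count-replicate P? (suc c) xs = trans (count-++ P? xs _) (cong (count P? xs +_) (count-replicate P? c xs))

count-concatMap : (P? : Decidable P) (f : B → List A) → ∀ bs →
                  count P? (concatMap f bs) ≡ sum (map (λ b → count P? (f b)) bs)
count-concatMap P? f []       = refl
count-concatMap P? f (b ∷ bs) = trans (count-++ P? (f b) _) (cong (count P? (f b) +_) (count-concatMap P? f bs))

infix 4 _⊑_ _⊑?_

data _⊑_ : ∀ {n} → Vec Bool n → Vec Bool n → Set where
  []  : [] ⊑ []
  _∷_ : ∀ {n b c} {p q : Vec Bool n} → b Bool.≤ c → p ⊑ q → b ∷ p ⊑ c ∷ q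

_⊑?_ : (p q : Vec Bool n) → Dec (p ⊑ q)
[]      ⊑? []      = yes []
(b ∷ p) ⊑? (c ∷ q) = map′ (λ (x , y) → x ∷ y) (λ { (x ∷ y) → x , y }) ((b Bool.≤? c) ×-dec (p ⊑? q))

tails : Bool → List (Vec Bool (suc n)) → List (Vec Bool n)
tails b []            = []
tails b ((c ∷ p) ∷ U) with b Bool.≟ c
... | yes _ = p ∷ tails b U
... | no  _ = tails b U

#⊑ : Vec Bool n → List (Vec Bool n) → ℕ
#⊑ q = count (_⊑? q)

#⊑ᶜ : Vec Bool n → List (Vec Bool n) → ℕ
#⊑ᶜ q = count (λ p → Vec.map not p ⊑? q)

#⊑-false : ∀ (q : Vec Bool n) U → #⊑ (false ∷ q) U ≡ #⊑ q (tails false U)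
#⊑-false q []                = refl
#⊑-false q ((true ∷ p) ∷ U)  = #⊑-false q U
#⊑-false q ((false ∷ p) ∷ U) with p ⊑? q
... | yes _ = cong suc (#⊑-false q U)
... | no  _ = #⊑-false q U

#⊑-true : ∀ (q : Vec Bool n) U → #⊑ (true ∷ q) U ≡ #⊑ q (tails false U) + #⊑ q (tails true U)
#⊑-true q []                = refl
#⊑-true q ((true ∷ p) ∷ U)  with p ⊑? q
... | yes _ = trans (cong suc (#⊑-true q U)) (sym (ℕ.+-suc (#⊑ q (tails false U)) _))
... | no  _ = #⊑-true q U
#⊑-true q ((false ∷ p) ∷ U) with p ⊑? q
... | yes _ = cong suc (#⊑-true q U)
... | no  _ = #⊑-true q U

#⊑ᶜ-false : ∀ (q : Vec Bool n) U → #⊑ᶜ (false ∷ q) U ≡ #⊑ᶜ q (tails true U)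
#⊑ᶜ-false q []                = refl
#⊑ᶜ-false q ((false ∷ p) ∷ U) = #⊑ᶜ-false q U
#⊑ᶜ-false q ((true ∷ p) ∷ U)  with Vec.map not p ⊑? q
... | yes _ = cong suc (#⊑ᶜ-false q U)
... | no  _ = #⊑ᶜ-false q U

#⊑ᶜ-true : ∀ (q : Vec Bool n) U → #⊑ᶜ (true ∷ q) U ≡ #⊑ᶜ q (tails false U) + #⊑ᶜ q (tails true U)
#⊑ᶜ-true q []                = refl
#⊑ᶜ-true q ((true ∷ p) ∷ U)  with Vec.map not p ⊑? q
... | yes _ = trans (cong suc (#⊑ᶜ-true q U)) (sym (ℕ.+-suc (#⊑ᶜ q (tails false U)) _))
... | no  _ = #⊑ᶜ-true q U
#⊑ᶜ-true q ((false ∷ p) ∷ U) with Vec.map not p ⊑? q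
... | yes _ = cong suc (#⊑ᶜ-true q U)
... | no  _ = #⊑ᶜ-true q U

-- The numbers #⊑ q U determine, by inclusion-exclusion, how often each vector
-- occurs in U.
complement-counts : ∀ (U V : List (Vec Bool n)) → (∀ q → #⊑ q U ≡ #⊑ q V) → ∀ q → #⊑ᶜ q U ≡ #⊑ᶜ q V
complement-counts {zero} U V eq [] = trans (empty U) (trans (eq []) (sym (empty V)))
  where
  empty : ∀ W → #⊑ᶜ [] W ≡ #⊑ [] W
  empty []       = refl
  empty ([] ∷ W) = cong suc (empty W)
complement-counts {suc n} U V eq = λ where
    (false ∷ q) → trans (#⊑ᶜ-false q U) (trans (trueᶜ q) (sym (#⊑ᶜ-false q V)))
    (true ∷ q)  → trans (#⊑ᶜ-true q U) (trans (cong₂ _+_ (falseᶜ q) (trueᶜ q)) (sym (#⊑ᶜ-true q V)))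
  where
  falses : ∀ q → #⊑ q (tails false U) ≡ #⊑ q (tails false V)
  falses q = trans (sym (#⊑-false q U)) (trans (eq (false ∷ q)) (#⊑-false q V))
  trues : ∀ q → #⊑ q (tails true U) ≡ #⊑ q (tails true V)
  trues q = ℕ.+-cancelˡ-≡ (#⊑ q (tails false U)) _ _ (trans (sym (#⊑-true q U)) (trans (eq (true ∷ q))
    (trans (#⊑-true q V) (cong (_+ #⊑ q (tails true V)) (sym (falses q))))))
  falseᶜ = complement-counts (tails false U) (tails false V) falses
  trueᶜ  = complement-counts (tails true U) (tails true V) trues

-- Compatibility as inclusion of ascent sets

ascents : Vec (Fin m) d → Vec Bool (pred d)
ascents []          = []
ascents (x ∷ [])    = []
ascents (x ∷ y ∷ a) = does (x <? y) ∷ ascents (y ∷ a)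

Sorted : Vec (Fin K) d → Set
Sorted is = Linked Fin._≤_ (toList is)

⇒-does : {P Q : Set} (P? : Dec P) (Q? : Dec Q) → (P → Q) → does P? Bool.≤ does Q?
⇒-does (no  _) (no  _)  _   = Bool.b≤b
⇒-does (no  _) (yes _)  _   = Bool.f≤t
⇒-does (yes _) (yes _)  _   = Bool.b≤b
⇒-does (yes p) (no  ¬q) p⇒q = contradiction (p⇒q p) ¬q

does-⇒ : {P Q : Set} (P? : Dec P) (Q? : Dec Q) → does P? Bool.≤ does Q? → P → Q
does-⇒ (no ¬p) _       _  p = contradiction p ¬p
does-⇒ (yes _) (yes q) _  _ = q
does-⇒ (yes _) (no  _) () _

-- Together with the converse for nondecreasing `is`, this makes the number of compatible words
-- depend only on the ascent sets of the words.
compatible⇒⊑ : ∀ (a : Vec (Fin m) d) (is : Vec (Fin K) d) → Compatible a is → ascents a ⊑ ascents is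
compatible⇒⊑ []          []           _               = []
compatible⇒⊑ (x ∷ [])    (i ∷ [])     _               = []
compatible⇒⊑ (x ∷ y ∷ a) (i ∷ j ∷ is) ((_ , lt) ∷ c) = ⇒-does (x <? y) (i <? j) lt ∷ compatible⇒⊑ (y ∷ a)
    (j ∷ is) c

⊑⇒compatible : ∀ (a : Vec (Fin m) d) (is : Vec (Fin K) d) → Sorted is → ascents a ⊑ ascents is → Compatible a is
⊑⇒compatible []          []           _       _       = []
⊑⇒compatible (x ∷ [])    (i ∷ [])     _       _       = [-]
⊑⇒compatible (x ∷ y ∷ a) (i ∷ j ∷ is) (i≤j ∷ l) (b ∷ bs) =
  (i≤j , does-⇒ (x <? y) (i <? j) b) ∷ ⊑⇒compatible (y ∷ a) (j ∷ is) l bs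

compatible′⇒⊑ : ∀ (a : Vec (Fin m) d) (is : Vec (Fin K) d) → Compatible′ a is →
    Vec.map not (ascents a) ⊑ ascents is
compatible′⇒⊑ []          []           _               = []
compatible′⇒⊑ (x ∷ [])    (i ∷ [])     _               = []
compatible′⇒⊑ (x ∷ y ∷ a) (i ∷ j ∷ is) ((_ , lt) ∷ c) =
  ⇒-does (¬? (x <? y)) (i <? j) (lt ∘ ℕ.≮⇒≥) ∷ compatible′⇒⊑ (y ∷ a) (j ∷ is) c

⊑⇒compatible′ : ∀ (a : Vec (Fin m) d) (is : Vec (Fin K) d) → Sorted is → Vec.map not (ascents a) ⊑ ascents is →
    Compatible′ a is
⊑⇒compatible′ []          []           _       _       = []
⊑⇒compatible′ (x ∷ [])    (i ∷ [])     _       _       = [-]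
⊑⇒compatible′ (x ∷ y ∷ a) (i ∷ j ∷ is) (i≤j ∷ l) (b ∷ bs) =
  (i≤j , does-⇒ (¬? (x <? y)) (i <? j) b ∘ ℕ.≤⇒≯) ∷ ⊑⇒compatible′ (y ∷ a) (j ∷ is) l bs

step′? : (p q : Fin m × Fin K) → Dec (Step′ p q)
step′? (a , i) (a′ , i′) = (i Fin.≤? i′) ×-dec ((a′ Fin.≤? a) →-dec (i <? i′))

compatible′? : (a : Vec (Fin m) d) (is : Vec (Fin K) d) → Dec (Compatible′ a is)
compatible′? a is = Linked.linked? step′? (pairs a is)

ascents-suc : (is : Vec (Fin K) d) → ascents (Vec.map Fin.suc is) ≡ ascents is
ascents-suc []           = refl
ascents-suc (i ∷ [])     = refl
ascents-suc (i ∷ j ∷ is) = cong (_ ∷_) (ascents-suc (j ∷ is))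

sorted-suc : (is : Vec (Fin K) d) → Sorted is → Sorted (Vec.map Fin.suc is)
sorted-suc []           _        = []
sorted-suc (i ∷ [])     _        = [-]
sorted-suc (i ∷ j ∷ is) (le ∷ l) = s≤s le ∷ sorted-suc (j ∷ is) l

-- Every set of positions is the ascent set of some index sequence, so an identity for all sorted
-- sequences is one for all subsets, as inclusion-exclusion requires.
indices-with : ∀ d (q : Vec Bool (pred d)) → ∃₂ λ K (is : Vec (Fin K) d) → Sorted is × ascents is ≡ q
indices-with zero          []          = 0 , [] , [] , refl
indices-with (suc zero)    []          = 1 , zero ∷ [] , [-] , refl
indices-with (suc (suc d)) (true ∷ q)  with indices-with (suc d) q
... | K , i ∷ is , l , eq = suc K , zero ∷ Vec.map suc (i ∷ is) , z≤n ∷ sorted-suc (i ∷ is) l , cong (true ∷_)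
    (trans (ascents-suc (i ∷ is)) eq)
indices-with (suc (suc d)) (false ∷ q) with indices-with (suc d) q
... | K , i ∷ is , l , eq = K , i ∷ i ∷ is , ℕ.≤-refl ∷ l , cong₂ _∷_ (dec-false (i <? i) (ℕ.<-irrefl refl)) eq

-- This is the effect of the involution ω on an expansion of a quasisymmetric
-- function into fundamental ones.
module _ {m₀} (U : List (Vec (Fin m₀) d)) (c : B → ℕ) (m : B → ℕ) (X : ∀ b → List (Vec (Fin (m b)) d))
    (bs : List B) where

  private
    -- The coefficients become repetitions, so that the right-hand side too counts the members of
    -- one list.
    V : List (Vec Bool (pred d))
    V = concatMap (λ b → concat (replicate (c b) (map ascents (X b)))) bs

    count-V : {P : Pred (Vec Bool (pred d)) 0ℓ} (P? : Decidable P) →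
        count P? V ≡ sum (map (λ b → c b * count P? (map ascents (X b))) bs)
    count-V P? = trans (count-concatMap P? (λ b → concat (replicate (c b) (map ascents (X b)))) bs)
      (cong sum (map-cong (λ b → count-replicate P? (c b) _) bs))

    count-compatible : (is : Vec (Fin K) d) → Sorted is → ∀ {m} (W : List (Vec (Fin m) d)) →
      count (λ a → compatible? a is) W ≡ #⊑ (ascents is) (map ascents W)
    count-compatible is l W = count-map _ _ ascents W (λ a → compatible⇒⊑ a is) (λ a → ⊑⇒compatible a is l)

    count-compatible′ : (is : Vec (Fin K) d) → Sorted is → ∀ {m} (W : List (Vec (Fin m) d)) →
      count (λ a → compatible′? a is) W ≡ #⊑ᶜ (ascents is) (map ascents W)
    count-compatible′ is l W = count-map _ _ ascents W (λ a → compatible′⇒⊑ a is) (λ a → ⊑⇒compatible′ a is l)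

  ω-expansion :
    (∀ {K} (is : Vec (Fin K) d) → Sorted is →
      count (λ a → compatible? a is) U ≡ sum (map (λ b → c b * count (λ a → compatible? a is) (X b)) bs)) →
    (∀ {K} (is : Vec (Fin K) d) → Sorted is →
      count (λ a → compatible′? a is) U ≡ sum (map (λ b → c b * count (λ a → compatible′? a is) (X b)) bs))
  ω-expansion expand is l = begin
    count (λ a → compatible′? a is) U        ≡⟨ count-compatible′ is l U ⟩
    #⊑ᶜ (ascents is) (map ascents U)         ≡⟨ complement-counts (map ascents U) V counts (ascents is) ⟩
    #⊑ᶜ (ascents is) V                       ≡⟨ count-V _ ⟩
    sum (map (λ b → c b * #⊑ᶜ (ascents is) (map ascents (X b))) bs)
      ≡⟨ cong sum (map-cong (λ b → cong (c b *_) (sym (count-compatible′ is l (X b)))) bs) ⟩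
    sum (map (λ b → c b * count (λ a → compatible′? a is) (X b)) bs) ∎
    where
    open ≡-Reasoning
    counts : ∀ q → #⊑ q (map ascents U) ≡ #⊑ q V
    counts q with indices-with d q
    ... | K , js , l′ , refl = begin
      #⊑ (ascents js) (map ascents U) ≡⟨ sym (count-compatible js l′ U) ⟩
      count (λ a → compatible? a js) U ≡⟨ expand js l′ ⟩
      sum (map (λ b → c b * count (λ a → compatible? a js) (X b)) bs)
        ≡⟨ cong sum (map-cong (λ b → cong (c b *_) (count-compatible js l′ (X b))) bs) ⟩
      sum (map (λ b → c b * #⊑ (ascents js) (map ascents (X b))) bs) ≡⟨ sym (count-V _) ⟩
      #⊑ (ascents js) V ∎

-- Coefficients of sorted contents

occurrences : Fin k → List (Fin k) → ℕ
occurrences v = count (v ≟_)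

sum-tabulate-bump : ∀ (x : Fin k) (f g : Fin k → ℕ) → f x ≡ suc (g x) → (∀ v → v ≢ x → f v ≡ g v) →
                    Vec.sum (Vec.tabulate f) ≡ suc (Vec.sum (Vec.tabulate g))
sum-tabulate-bump zero    f g at off = cong₂ _+_ at (cong Vec.sum (Vec.tabulate-cong (λ v → off (suc v) λ ())))
sum-tabulate-bump (suc x) f g at off = trans
  (cong₂ _+_ (off zero λ ()) (sum-tabulate-bump x (f ∘ suc) (g ∘ suc) at λ v v≢x →
      off (suc v) (v≢x ∘ Fin.suc-injective)))
  (ℕ.+-suc (g zero) _)

sum-content : (l : List (Fin k)) → Vec.sum (content l) ≡ length l
sum-content {k} []      = zeros k
  where
  zeros : ∀ k → Vec.sum (Vec.tabulate {n = k} λ _ → 0) ≡ 0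
  zeros zero    = refl
  zeros (suc k) = zeros k
sum-content (x ∷ l) = trans
  (sum-tabulate-bump x (λ v → occurrences v (x ∷ l)) (λ v → occurrences v l)
    (count-yes (x ≟_) l refl) (λ v v≢x → count-no (v ≟_) l v≢x))
  (cong suc (sum-content l))

content-↭ : {l l′ : List (Fin k)} → l ↭ l′ → content l ≡ content l′
content-↭ p = Vec.tabulate-cong λ v → ↭-length (filter-↭ (v ≟_) p)

content-occurrences : (l l′ : List (Fin k)) → content l ≡ content l′ → ∀ v → occurrences v l ≡ occurrences v l′
content-occurrences l l′ eq v =
    trans (sym (Vec.lookup∘tabulate _ v)) (trans (cong (λ α → lookup α v) eq) (Vec.lookup∘tabulate _ v))

absent : ∀ {x y : Fin k} {l} → x Fin.< y → All (y Fin.≤_) l → occurrences x (y ∷ l) ≡ 0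
absent {x = x} x<y p = cong length (filter-none (x ≟_)
  (All.map (λ y≤z x≡z → ℕ.<-irrefl (cong toℕ x≡z) (ℕ.<-≤-trans x<y y≤z)) (ℕ.≤-refl ∷ p)))

sorted-by-content : {l l′ : List (Fin k)} → AllPairs Fin._≤_ l → AllPairs Fin._≤_ l′ →
                    (∀ v → occurrences v l ≡ occurrences v l′) → l ≡ l′
sorted-by-content [] [] eq = refl
sorted-by-content {l′ = y ∷ l′} [] _ eq = contradiction (trans (eq y) (count-yes (y ≟_) l′ refl)) λ ()
sorted-by-content {l = x ∷ l} _ [] eq = contradiction (trans (sym (eq x)) (count-yes (x ≟_) l refl)) λ ()
sorted-by-content {l = x ∷ l} {y ∷ l′} (px ∷ pl) (py ∷ pl′) eq with Fin.<-cmp x y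
... | tri< x<y _ _ = contradiction (trans (sym (count-yes (x ≟_) l refl)) (trans (eq x) (absent x<y py))) λ ()
... | tri> _ _ y<x = contradiction (trans (sym (count-yes (y ≟_) l′ refl)) (trans (sym (eq y)) (absent y<x px)))
    λ ()
... | tri≈ _ refl _ = cong (x ∷_) (sorted-by-content pl pl′ tail)
  where
  tail : ∀ v → occurrences v l ≡ occurrences v l′
  tail v with v ≟ x
  ... | yes refl = ℕ.suc-injective
      (trans (sym (count-yes (v ≟_) l refl)) (trans (eq v) (count-yes (v ≟_) l′ refl)))
  ... | no v≢x   = trans (sym (count-no (v ≟_) l v≢x)) (trans (eq v) (count-no (v ≟_) l′ v≢x))

count-none : (P? : Decidable P) → ∀ xs → (∀ x → x ∈ xs → ¬ P x) → count P? xs ≡ 0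
count-none P? xs none = cong length (filter-none P? (All.tabulate λ {x} → none x))

count-one : (P? : Decidable P) → ∀ {x xs} → Unique xs → x ∈ xs → P x → (∀ y → P y → y ≡ x) → count P? xs ≡ 1
count-one P? {xs = y ∷ xs} (y∉ ∷ u) (here refl) px only =
  trans (count-yes P? xs px) (cong suc (count-none P? xs λ z z∈ pz → All.lookup y∉ z∈ (sym (only z pz))))
count-one P? {xs = y ∷ xs} (y∉ ∷ u) (there x∈) px only =
  trans (count-no P? xs λ py → All.lookup y∉ x∈ (only y py)) (count-one P? u x∈ px only)

count-filter : (P? : Decidable P) (Q? : Decidable Q) → ∀ xs →
    count P? (filter Q? xs) ≡ count (λ x → Q? x ×-dec P? x) xs
count-filter P? Q? []       = refl
count-filter P? Q? (x ∷ xs) with Q? x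
... | no  _ = count-filter P? Q? xs
... | yes _ with P? x
...   | yes _ = cong suc (count-filter P? Q? xs)
...   | no  _ = count-filter P? Q? xs

sum-indicator : (P? : Decidable P) (f : A → ℕ) → (∀ x → P x → f x ≡ 1) → (∀ x → ¬ P x → f x ≡ 0) →
                ∀ xs → sum (map f xs) ≡ count P? xs
sum-indicator P? f one none []       = refl
sum-indicator P? f one none (x ∷ xs) with P? x
... | yes px = cong₂ _+_ (one x px) (sum-indicator P? f one none xs)
... | no ¬px = cong₂ _+_ (none x ¬px) (sum-indicator P? f one none xs)

count-bijection : {P : Pred A 0ℓ} {Q : Pred B 0ℓ} (P? : Decidable P) (Q? : Decidable Q) (f : A → B)
    {xs : List A} {ys : List B} → Unique xs → Unique ys →
  (∀ {x} → x ∈ xs → P x → f x ∈ ys × Q (f x)) →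
  (∀ {x x′} → P x → P x′ → f x ≡ f x′ → x ≡ x′) →
  (∀ {y} → y ∈ ys → Q y → ∃ λ x → x ∈ xs × P x × f x ≡ y) →
  count P? xs ≡ count Q? ys
count-bijection P? Q? f {xs} {ys} ux uy to inj onto = trans (sym (length-map f (filter P? xs)))
  (↭-length (∼bag⇒↭ (unique∧set⇒bag (unique-map (AllPairs.filter⁺ P? ux) (All.all-filter P? xs))
      (Unique.filter⁺ Q? uy) (mk⇔
    (λ y∈ → let x , x∈ , eq = ∈-map⁻ f y∈ ; x∈xs , px = ∈-filter⁻ P? x∈ ; fx∈ , qfx = to x∈xs px in
            subst (_∈ filter Q? ys) (sym eq) (∈-filter⁺ Q? fx∈ qfx))
    (λ y∈ → let y∈ys , qy = ∈-filter⁻ Q? y∈ ; x , x∈ , px , eq = onto y∈ys qy in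
            subst (_∈ map f (filter P? xs)) eq (∈-map⁺ f (∈-filter⁺ P? x∈ px)))))))
  where
  unique-map : ∀ {zs} → Unique zs → All _ zs → Unique (map f zs)
  unique-map []       []       = []
  unique-map (z∉ ∷ u) (pz ∷ ps) =
    All.map⁺ (All.zipWith (λ (z≢ , pz′) eq → z≢ (inj pz pz′ eq)) (z∉ , ps)) ∷ unique-map u ps

tuples-unique : ∀ {xs : List A} → Unique xs → ∀ k → Unique (tuples xs k)
tuples-unique u zero    = [] ∷ []
tuples-unique u (suc k) = Unique.cartesianProductWith⁺ _∷_ Vec.∷-injective u (tuples-unique u k)

words-unique : ∀ m k → Unique (words m k)
words-unique m = tuples-unique (Unique.allFin⁺ m)

related⇒sorted : ∀ {R : Fin m × Fin K → Fin m × Fin K → Set} → (∀ {p q} → R p q → proj₂ p Fin.≤ proj₂ q) →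
                 ∀ (a : Vec (Fin m) d) (is : Vec (Fin K) d) → Linked R (pairs a is) → Sorted is
related⇒sorted ≤ᵢ []          []           _       = []
related⇒sorted ≤ᵢ (x ∷ [])    (i ∷ [])     _       = [-]
related⇒sorted ≤ᵢ (x ∷ y ∷ a) (i ∷ j ∷ is) (p ∷ c) = ≤ᵢ p ∷ related⇒sorted ≤ᵢ (y ∷ a) (j ∷ is) c

compatible⇒sorted : ∀ (a : Vec (Fin m) d) (is : Vec (Fin K) d) → Compatible a is → Sorted is
compatible⇒sorted = related⇒sorted proj₁

compatible′⇒sorted : ∀ (a : Vec (Fin m) d) (is : Vec (Fin K) d) → Compatible′ a is → Sorted is
compatible′⇒sorted = related⇒sorted proj₁

sorted-pairs : (is : Vec (Fin K) d) → Sorted is → AllPairs Fin._≤_ (toList is)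
sorted-pairs is = Linked.Linked⇒AllPairs Fin.≤-trans

toList-injective : ∀ {u v : Vec A d} → toList u ≡ toList v → u ≡ v
toList-injective {u = []}    {[]}    _  = refl
toList-injective {u = x ∷ u} {y ∷ v} eq =
    cong₂ _∷_ (proj₁ (∷-injective eq)) (toList-injective (proj₂ (∷-injective eq)))

sorted-unique : ∀ (is js : Vec (Fin K) d) → Sorted is → Sorted js → content (toList is) ≡ content (toList js) →
    is ≡ js
sorted-unique is js l l′ eq =
    toList-injective (sorted-by-content (sorted-pairs is l) (sorted-pairs js l′)
    (content-occurrences (toList is) (toList js) eq))

length-toList : (v : Vec A d) → length (toList v) ≡ d
length-toList []      = refl
length-toList (x ∷ v) = cong suc (length-toList v)

-- A content has only one nondecreasing arrangement, so a reduced word contributes 1 or 0 to the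
-- coefficient according to whether it is compatible with `is`.
stanley-content : (w : Permutation′ n) (is : Vec (Fin K) d) → Sorted is →
  stanley w K (content (toList is)) ≡ count (λ a → compatible? a is) (Red w d)
stanley-content {K = K} {d} w is l = helper (trans (sum-content (toList is)) (length-toList is))
  where
  -- `stanley` reads the length of the words off the exponents; that it is `d` holds only
  -- propositionally, hence the detour through `e`.
  helper : ∀ {e} → e ≡ d →
      sum (map (λ a → length (filter (λ js → hasContent? (content (toList is)) (toList js)) (I a K))) (Red w e))
      ≡
                           count (λ a → compatible? a is) (Red w d)
  helper refl = sum-indicator (λ a → compatible? a is) _
    (λ a c → trans (count-filter _ (compatible? a) (words K d))
       (count-one _ (words-unique K _) (∈-words is) (c , refl) λ js (cj , eq) →
           sorted-unique js is (compatible⇒sorted a js cj) l eq))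
    (λ a ¬c → trans (count-filter _ (compatible? a) (words K d))
       (count-none _ (words K d) λ js _ (cj , eq) →
           ¬c (subst (Compatible a) (sorted-unique js is (compatible⇒sorted a js cj) l eq) cj)))
    (Red w d)

-- Words and rows

at : Fin m → List (Fin m × A) → List (Fin m × A)
at ρ = filter (λ p → ρ ≟ proj₁ p)

row : Fin m → List (Fin m × A) → List A
row ρ L = map proj₂ (at ρ L)

cells : (Fin m → List A) → List (Fin m × A)
cells {m} t = concatMap (λ ρ → map (ρ ,_) (t ρ)) (allFin m)

module _ {m} (p : Fin m × A) (L : List (Fin m × A)) where
  private
    group : List (Fin m × A) → List (Fin m) → List (Fin m × A)
    group M = concatMap (λ ρ → at ρ M)

    group-absent : ∀ {ks} → All (proj₁ p ≢_) ks → group (p ∷ L) ks ≡ group L ks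
    group-absent []         = refl
    group-absent {ρ ∷ _} (ne ∷ nes) = cong₂ _++_ (filter-reject (λ q → ρ ≟ proj₁ q) {p} {L} (ne ∘ sym))
        (group-absent nes)

  group-∷ : ∀ {ks} → Unique ks → proj₁ p ∈ ks → group (p ∷ L) ks ↭ p ∷ group L ks
  group-∷ {ρ ∷ ks} (ρ∉ ∷ u) (here refl)
    rewrite filter-accept (λ q → ρ ≟ proj₁ q) {p} {L} refl | group-absent ρ∉ = ↭-refl
  group-∷ {ρ ∷ ks} (ρ∉ ∷ u) (there p∈)
    rewrite filter-reject (λ q → ρ ≟ proj₁ q) {p} {L} (All.lookup ρ∉ p∈)
    = ↭-trans (++⁺ˡ (at ρ L) (group-∷ u p∈)) (shift p (at ρ L) _)

regroup : (L : List (Fin m × A)) → concatMap (λ ρ → at ρ L) (allFin m) ↭ L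
regroup {m} {A} []  = ↭-reflexive (none (allFin m))
  where
  none : ∀ (ks : List (Fin m)) → concatMap (λ _ → [] {A = Fin m × A}) ks ≡ []
  none []       = refl
  none (_ ∷ ks) = none ks
regroup {m} (p ∷ L) = ↭-trans (group-∷ p L (Unique.allFin⁺ m) (∈-allFin (proj₁ p))) (prep p (regroup L))

at-key : ∀ ρ (L : List (Fin m × A)) → map (ρ ,_) (row ρ L) ≡ at ρ L
at-key ρ L = relabel (All.all-filter (λ p → ρ ≟ proj₁ p) L)
  where
  relabel : ∀ {M} → All (λ p → ρ ≡ proj₁ p) M → map (ρ ,_) (map proj₂ M) ≡ M
  relabel []          = refl
  relabel (refl ∷ es) = cong (_ ∷_) (relabel es)

cells-row : (L : List (Fin m × A)) → cells (λ ρ → row ρ L) ↭ L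
cells-row {m} L = ↭-trans (↭-reflexive (concatMap-cong (λ ρ → at-key ρ L) (allFin m))) (regroup L)

cells-cong : {t t′ : Fin m → List A} → (∀ ρ → t ρ ≡ t′ ρ) → cells t ≡ cells t′
cells-cong {m} eq = concatMap-cong (λ ρ → cong (map (ρ ,_)) (eq ρ)) (allFin m)

row-cells : ∀ (t : Fin m → List A) ρ → row ρ (cells t) ≡ t ρ
row-cells {m} {A} t ρ = trans (cong (map proj₂) (found (Unique.allFin⁺ m) (∈-allFin ρ)))
    (trans (sym (map-∘ (t ρ))) (map-id (t ρ)))
  where
  block : Fin m → List (Fin m × A)
  block σ = map (σ ,_) (t σ)

  at-own : at ρ (block ρ) ≡ block ρ
  at-own = filter-all _ (All.map⁺ (All.universal (λ _ → refl) (t ρ)))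

  at-other : ∀ {σ} → ρ ≢ σ → at ρ (block σ) ≡ []
  at-other {σ} ρ≢σ = filter-none _ (All.map⁺ (All.universal (λ _ → ρ≢σ) (t σ)))

  missing : ∀ {ks} → All (ρ ≢_) ks → at ρ (concatMap block ks) ≡ []
  missing []                   = refl
  missing {σ ∷ ks} (ne ∷ nes) = trans (filter-++ _ (block σ) _) (cong₂ _++_ (at-other ne) (missing nes))

  found : ∀ {ks} → Unique ks → ρ ∈ ks → at ρ (concatMap block ks) ≡ block ρ
  found {σ ∷ ks} (σ∉ ∷ u) (here refl) =
      trans (filter-++ _ (block σ) _) (trans (cong₂ _++_ at-own (missing σ∉)) (++-identityʳ _))
  found {σ ∷ ks} (σ∉ ∷ u) (there ρ∈)  =
      trans (filter-++ _ (block σ) _) (cong₂ _++_ (at-other (All.lookup σ∉ ρ∈ ∘ sym)) (found u ρ∈))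

positions : Vec (Fin m) d → Fin m → List (Fin d)
positions r ρ = filter (λ j → ρ ≟ lookup r j) (allFin _)

-- If `r` tells in which row of a standard tableau each `j` lies, this replaces the entry `j` by the
-- index at `j`, which undoes standardization.
tableau : Vec (Fin m) d → Vec A d → Fin m → List A
tableau r is ρ = map (lookup is) (positions r ρ)

pairs-tabulate : (a : Vec A d) (b : Vec B d) → pairs a b ≡ List.tabulate λ j → lookup a j , lookup b j
pairs-tabulate []      []      = refl
pairs-tabulate (x ∷ a) (y ∷ b) = cong ((x , y) ∷_) (pairs-tabulate a b)

at-map : ∀ (ρ : Fin m) (h : B → Fin m × A) xs → at ρ (map h xs) ≡ map h (filter (λ j → ρ ≟ proj₁ (h j)) xs)
at-map ρ h []       = refl
at-map ρ h (x ∷ xs) with ρ ≟ proj₁ (h x)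
... | yes _ = cong (h x ∷_) (at-map ρ h xs)
... | no  _ = at-map ρ h xs

tableau-row : ∀ (r : Vec (Fin m) d) (is : Vec A d) ρ → tableau r is ρ ≡ row ρ (pairs r is)
tableau-row {d = d} r is ρ = begin
  map (lookup is) (positions r ρ)              ≡⟨ map-∘ (positions r ρ) ⟩
  map proj₂ (map h (positions r ρ))            ≡⟨ cong (map proj₂) (sym (at-map ρ h (allFin d))) ⟩
  row ρ (map h (allFin d))
    ≡⟨ cong (row ρ) (trans (map-tabulate _ h) (sym (pairs-tabulate r is))) ⟩
  row ρ (pairs r is)                           ∎
  where
  open ≡-Reasoning
  h = λ j → lookup r j , lookup is j

cells-tableau : (r : Vec (Fin m) d) (is : Vec A d) → cells (tableau r is) ↭ pairs r is
cells-tableau r is = ↭-trans (↭-reflexive (cells-cong (tableau-row r is))) (cells-row (pairs r is))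

map-proj₂-pairs : (a : Vec A d) (b : Vec B d) → map proj₂ (pairs a b) ≡ toList b
map-proj₂-pairs []      []      = refl
map-proj₂-pairs (x ∷ a) (y ∷ b) = cong (y ∷_) (map-proj₂-pairs a b)

map-proj₂-cells : (t : Fin m → List A) → map proj₂ (cells t) ≡ concat (map t (allFin m))
map-proj₂-cells {m} t = flatten (allFin m)
  where
  flatten : ∀ ks → map proj₂ (concatMap (λ ρ → map (ρ ,_) (t ρ)) ks) ≡ concat (map t ks)
  flatten []       = refl
  flatten (ρ ∷ ks) = trans (map-++ proj₂ (map (ρ ,_) (t ρ)) _)
      (cong₂ _++_ (trans (sym (map-∘ (t ρ))) (map-id (t ρ))) (flatten ks))

pairs-with : (L : List (A × B)) (b : Vec B d) → map proj₂ L ≡ toList b → ∃ λ a → pairs a b ≡ L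
pairs-with []            []      _  = [] , refl
pairs-with ((x , z) ∷ L) (y ∷ b) eq with ∷-injective eq
... | refl , eq′ with pairs-with L b eq′
...   | a , refl = x ∷ a , refl

pairs-injective : ∀ {a a′ : Vec A d} {b b′ : Vec B d} → pairs a b ≡ pairs a′ b′ → a ≡ a′
pairs-injective {a = []}    {[]}               _  = refl
pairs-injective {a = x ∷ a} {x′ ∷ a′} {y ∷ b} {y′ ∷ b′} eq with ∷-injective eq
... | refl , eq′ = cong (x ∷_) (pairs-injective eq′)

module _ {R : A × B → A × B → Set} where
  pairs-All : ∀ {p} {a : Vec A d} {b : Vec B d} → All (R p) (pairs a b) → ∀ v → R p (lookup a v , lookup b v)
  pairs-All {a = x ∷ a} {y ∷ b} (px ∷ ps) zero    = px
  pairs-All {a = x ∷ a} {y ∷ b} (px ∷ ps) (suc v) = pairs-All ps v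

  pairs-AllPairs : ∀ {a : Vec A d} {b : Vec B d} → AllPairs R (pairs a b) →
                   ∀ {u v} → u Fin.< v → R (lookup a u , lookup b u) (lookup a v , lookup b v)
  pairs-AllPairs {a = x ∷ a} {y ∷ b} (px ∷ ps) {zero}  {suc v} _ = pairs-All px v
  pairs-AllPairs {a = x ∷ a} {y ∷ b} (px ∷ ps) {suc u} {suc v} (s≤s u<v) = pairs-AllPairs ps u<v

-- Lattice words

positionRows : Vec (Fin m) d → List (List (Fin d))
positionRows {m} r = map (positions r) (allFin m)

-- The standard filling with the entries j of row r_j is a tableau of shape μ.
Lattice : (μ : Partition) → Vec (Fin (length (parts μ))) d → Set
Lattice μ r = map length (positionRows r) ≡ parts μ × Linked _Above_ (positionRows r)

lattice? : (μ : Partition) (r : Vec (Fin (length (parts μ))) d) → Dec (Lattice μ r)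
lattice? μ r = List.≡-dec ℕ._≟_ (map length (positionRows r)) (parts μ) ×-dec Linked.linked? above?
    (positionRows r)

latticeWords : (μ : Partition) (d : ℕ) → List (Vec (Fin (length (parts μ))) d)
latticeWords μ d = filter (lattice? μ) (words (length (parts μ)) d)

Above⇒Prefix : ∀ {us vs : List (Fin k)} → us Above vs → Prefix (flip Fin._<_) vs us
Above⇒Prefix []      = []
Above⇒Prefix (p ∷ a) = p ∷ Above⇒Prefix a

Prefix⇒Above : ∀ {us vs : List (Fin k)} → Prefix (flip Fin._<_) vs us → us Above vs
Prefix⇒Above []      = []
Prefix⇒Above (p ∷ a) = p ∷ Prefix⇒Above a

prefix-map : {S S′ : A → A → Set} {P P′ : Pred A 0ℓ} → (∀ {u v} → P u → P′ v → S v u → S′ v u) →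
             ∀ {us vs} → All P us → All P′ vs → Prefix S vs us → Prefix S′ vs us
prefix-map h _          _          []       = []
prefix-map h (pu ∷ pus) (pv ∷ pvs) (s ∷ ss) = h pu pv s ∷ prefix-map h pus pvs ss

increasing-allFin : ∀ m → Linked Fin._<_ (allFin m)
increasing-allFin m = Linked.AllPairs⇒Linked (AllPairs.tabulate⁺-< λ i<j → i<j)

positions-at : ∀ (r : Vec (Fin m) d) ρ → All (λ j → ρ ≡ lookup r j) (positions r ρ)
positions-at {d = d} r ρ = All.all-filter (λ j → ρ ≟ lookup r j) (allFin d)

-- Words sorted by values and, for equal values, against an order of the letters

module Ordered {m} (_⊏_ : Fin m → Fin m → Set) (sto : IsStrictTotalOrder _≡_ _⊏_) (k : ℕ) where
  private module ⊏ = IsStrictTotalOrder sto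

  infix 4 _≼_
  _≼_ : Fin m × Fin k → Fin m × Fin k → Set
  (a , i) ≼ (a′ , i′) = i Fin.≤ i′ × (a ⊏ a′ → i Fin.< i′)

  ≼-trans : Transitive _≼_
  ≼-trans {a , i} {a′ , i′} {a″ , i″} (le , lt) (le′ , lt′) = ℕ.≤-trans le le′ , strict
    where
    strict : a ⊏ a″ → i Fin.< i″
    strict a⊏a″ with ⊏.compare a a′
    ... | tri< a⊏a′ _ _ = ℕ.<-≤-trans (lt a⊏a′) le′
    ... | tri≈ _ refl _ = ℕ.≤-<-trans le (lt′ a⊏a″)
    ... | tri> _ _ a′⊏a = ℕ.≤-<-trans le (lt′ (⊏.trans a′⊏a a⊏a″))

  ≼-antisym : ∀ {p q} → p ≼ q → q ≼ p → p ≡ q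
  ≼-antisym {a , i} {a′ , i′} (le , lt) (le′ , lt′) with ⊏.compare a a′
  ... | tri< a⊏a′ _ _ = contradiction (lt a⊏a′) (ℕ.≤⇒≯ le′)
  ... | tri≈ _ refl _ = cong (a ,_) (Fin.≤-antisym le le′)
  ... | tri> _ _ a′⊏a = contradiction (lt′ a′⊏a) (ℕ.≤⇒≯ le)

  ≼-total : ∀ p q → p ≼ q ⊎ q ≼ p
  ≼-total (a , i) (a′ , i′) with Fin.<-cmp i i′ | ⊏.compare a a′
  ... | tri< i<i′ _ _ | _               = inj₁ (ℕ.<⇒≤ i<i′ , λ _ → i<i′)
  ... | tri> _ _ i′<i | _               = inj₂ (ℕ.<⇒≤ i′<i , λ _ → i′<i)
  ... | tri≈ _ refl _ | tri< a⊏a′ _ a′⊏̸a = inj₂ (ℕ.≤-refl , λ a′⊏a → contradiction a′⊏a a′⊏̸a)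
  ... | tri≈ _ refl _ | tri≈ a⊏̸a′ _ _   = inj₁ (ℕ.≤-refl , λ a⊏a′ → contradiction a⊏a′ a⊏̸a′)
  ... | tri≈ _ refl _ | tri> a⊏̸a′ _ _   = inj₁ (ℕ.≤-refl , λ a⊏a′ → contradiction a⊏a′ a⊏̸a′)

  order : DecTotalOrder 0ℓ 0ℓ 0ℓ
  order = record
    { Carrier = Fin m × Fin k ; _≈_ = _≡_ ; _≤_ = _≼_
    ; isDecTotalOrder = record
      { isTotalOrder = record
        { isPartialOrder = record
          { isPreorder = record
            { isEquivalence = isEquivalence
            ; reflexive = λ { refl → ℕ.≤-refl , λ a⊏a → contradiction a⊏a (⊏.irrefl refl) }
            ; trans = ≼-trans }
          ; antisym = ≼-antisym }
        ; total = ≼-total }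
      ; _≟_ = Product.≡-dec _≟_ _≟_
      ; _≤?_ = λ (a , i) (a′ , i′) → (i Fin.≤? i′) ×-dec ((a ⊏.<? a′) →-dec (i <? i′)) } }

  open import Data.List.Sort order using (sort; sort-↭; sort-↗) public

  sorted-↭ : ∀ {L M} → Linked _≼_ L → Linked _≼_ M → L ↭ M → L ≡ M
  sorted-↭ l l′ p = Pointwise-≡⇒≡ (↗↭↗⇒≋ (DecTotalOrder.totalOrder order) l l′ (↭⇒↭ₛ p))

  row-sorted : ∀ {L} → Linked _≼_ L → ∀ ρ → AllPairs Fin._≤_ (row ρ L)
  row-sorted l ρ = AllPairs.map⁺ (AllPairs.map proj₁ (AllPairs.filter⁺ _ (Linked.Linked⇒AllPairs ≼-trans l)))



  -- `Q j i` relates an entry `j` to the entry `i` above it. By `clash` the lower cell cannot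
  -- precede the upper one in the word, so the positions increase down each column.
  positions-above : (Q : Fin k → Fin k → Set) →
    (∀ {ρ ρ′ i j} → ρ Fin.< ρ′ → Q j i → ¬ (ρ′ , j) ≼ (ρ , i)) →
    ∀ (r : Vec (Fin m) d) is → Linked _≼_ (pairs r is) → ∀ {ρ ρ′} → ρ Fin.< ρ′ →
    Prefix Q (tableau r is ρ′) (tableau r is ρ) → positions r ρ Above positions r ρ′
  positions-above Q clash r is l {ρ} {ρ′} ρ<ρ′ pre =
    Prefix⇒Above (prefix-map ordered (positions-at r ρ) (positions-at r ρ′)
        (Prefix.map⁻ (lookup is) (lookup is) pre))
    where
    ordered : ∀ {u v} → ρ ≡ lookup r u → ρ′ ≡ lookup r v → Q (lookup is v) (lookup is u) → u Fin.< v
    ordered {u} {v} refl refl q with Fin.<-cmp u v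
    ... | tri< u<v _ _  = u<v
    ... | tri≈ _ refl _ = contradiction ρ<ρ′ (ℕ.<-irrefl refl)
    ... | tri> _ _ v<u  = contradiction (pairs-AllPairs {a = r} {is} (Linked.Linked⇒AllPairs ≼-trans l) v<u)
        (clash ρ<ρ′ q)

  record WordOf (t : Fin m → List (Fin k)) (is : Vec (Fin k) d) : Set where
    field
      word    : Vec (Fin m) d
      ordered : Linked _≼_ (pairs word is)
      filled  : ∀ ρ → tableau word is ρ ≡ t ρ
      perm    : pairs word is ↭ cells t
      above   : Linked _Above_ (positionRows word)

  -- Inverts `tableau`: the cells sorted by `_≼_` list the values as in `is`, and their row labels
  -- form the word.
  word-of : (Q : Fin k → Fin k → Set) →
    (∀ {ρ ρ′ i j} → ρ Fin.< ρ′ → Q j i → ¬ (ρ′ , j) ≼ (ρ , i)) →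
    ∀ t → (∀ ρ → AllPairs Fin._≤_ (t ρ)) → Linked (λ ρ ρ′ → Prefix Q (t ρ′) (t ρ)) (allFin m) →
    (is : Vec (Fin k) d) → map proj₂ (sort (cells t)) ≡ toList is → WordOf t is
  word-of Q clash t rows columns is eq with pairs-with (sort (cells t)) is eq
  ... | r , r≡ = record
    { word = r ; ordered = l ; filled = filled ; perm = perm
    ; above = Linked.map⁺ (Linked.zipWith (λ { {ρ} {ρ′} (ρ<ρ′ , pre) →
        positions-above Q clash r is l ρ<ρ′ (subst₂ (Prefix Q) (sym (filled ρ′)) (sym (filled ρ)) pre) })
        (increasing-allFin m , columns)) }
    where
    l : Linked _≼_ (pairs r is)
    l = subst (Linked _≼_) (sym r≡) (sort-↗ (cells t))
    perm : pairs r is ↭ cells t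
    perm = subst (_↭ cells t) (sym r≡) (sort-↭ (cells t))
    filled : ∀ ρ → tableau r is ρ ≡ t ρ
    filled ρ = trans (tableau-row r is ρ) (Pointwise-≡⇒≡ (↗↭↗⇒≋ (Fin.≤-totalOrder k)
      (Linked.AllPairs⇒Linked (row-sorted l ρ)) (Linked.AllPairs⇒Linked (rows ρ))
      (↭⇒↭ₛ (↭-trans (Perm.map⁺ proj₂ (filter-↭ (λ p → ρ ≟ proj₁ p) perm)) (↭-reflexive (row-cells t ρ))))))

  sorted-word-of : (Q : Fin k → Fin k → Set) →
    (∀ {ρ ρ′ i j} → ρ Fin.< ρ′ → Q j i → ¬ (ρ′ , j) ≼ (ρ , i)) →
    ∀ t → (∀ ρ → AllPairs Fin._≤_ (t ρ)) → Linked (λ ρ ρ′ → Prefix Q (t ρ′) (t ρ)) (allFin m) →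
    ∃₂ λ d (is : Vec (Fin k) d) → WordOf t is
  sorted-word-of Q clash t rows columns =
    _ , Vec.fromList values , word-of Q clash t rows columns (Vec.fromList values)
        (sym (Vec.toList∘fromList values))
    where values = map proj₂ (sort (cells t))

  word-unique : ∀ {r r′ : Vec (Fin m) d} {is} → Linked _≼_ (pairs r is) → Linked _≼_ (pairs r′ is) →
                (∀ ρ → tableau r is ρ ≡ tableau r′ is ρ) → r ≡ r′
  word-unique {r = r} {r′} {is} l l′ eq = pairs-injective (sorted-↭ l l′
    (↭-trans (↭-sym (cells-tableau r is)) (↭-trans (↭-reflexive (cells-cong eq)) (cells-tableau r′ is))))

rows-↭ : ∀ (r : Vec (Fin m) d) (is : Vec A d) t → pairs r is ↭ cells t → toList is ↭ concat (map t (allFin m))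
rows-↭ r is t p = subst₂ _↭_ (map-proj₂-pairs r is) (map-proj₂-cells t) (Perm.map⁺ proj₂ p)

numbers-toList : (is : Vec (Fin K) d) → numbers is ≡ map toℕ (toList is)
numbers-toList []       = refl
numbers-toList (i ∷ is) = cong (toℕ i ∷_) (numbers-toList is)

below-++ : ∀ k xs ys → below k (xs ++ ys) ≡ below k xs + below k ys
below-++ k xs ys = count-++ (ℕ._<? k) xs ys

below-concat : ∀ k (T : Filling K) → below k (map toℕ (concat T)) ≡ sum (map (λ us → below k (map toℕ us)) T)
below-concat k []       = refl
below-concat k (us ∷ T) = trans (cong (below k) (map-++ toℕ us (concat T)))
  (trans (below-++ k (map toℕ us) _) (cong (below k (map toℕ us) +_) (below-concat k T)))

below-rows : ∀ k (r : Vec (Fin m) d) (is : Vec (Fin K) d) t → pairs r is ↭ cells t →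
             below k (numbers is) ≡ sum (map (λ us → below k (map toℕ us)) (map t (allFin m)))
below-rows {m} k r is t p = trans (cong (below k) (numbers-toList is))
  (trans (below-↭ k (Perm.map⁺ toℕ (rows-↭ r is t p))) (below-concat k (map t (allFin m))))

-- Schur functions as sums over lattice words

∈-fillings⁺ : ∀ (T : Filling k) → T ∈ fillings k (map length T)
∈-fillings⁺ []       = here refl
∈-fillings⁺ {k} (us ∷ T) = ∈-cartesianProductWith⁺ _∷_
  (subst (_∈ map toList (words k (length us))) (Vec.toList∘fromList us)
      (∈-map⁺ toList (∈-words (Vec.fromList us)))) (∈-fillings⁺ T)

∈-fillings⁻ : ∀ rs {T : Filling k} → T ∈ fillings k rs → map length T ≡ rs
∈-fillings⁻ []       (here refl) = refl
∈-fillings⁻ {k} (r ∷ rs) T∈ with ∈-cartesianProductWith⁻ _∷_ (map toList (words k r)) (fillings k rs) T∈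
... | us , T , us∈ , T∈′ , refl with ∈-map⁻ toList us∈
...   | v , _ , refl = cong₂ _∷_ (length-toList v) (∈-fillings⁻ rs T∈′)

fillings-unique : ∀ rs → Unique (fillings k rs)
fillings-unique []           = [] ∷ []
fillings-unique {k} (r ∷ rs) = Unique.cartesianProductWith⁺ _∷_ ∷-injective
  (Unique.map⁺ toList-injective (words-unique k r)) (fillings-unique rs)

rows-of : ∀ {T : List (List A)} → length T ≡ m → ∃ λ (t : Fin m → List A) → map t (allFin m) ≡ T
rows-of {T = T} refl = List.lookup T , trans (map-tabulate _ (List.lookup T)) (tabulate-lookup T)

map-allFin-injective : ∀ {t t′ : Fin m → A} → map t (allFin m) ≡ map t′ (allFin m) → ∀ ρ → t ρ ≡ t′ ρ
map-allFin-injective {t = t} {t′} eq =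
    tabulate-injective (trans (sym (map-tabulate _ t)) (trans eq (map-tabulate _ t′)))

-- For `Increasing` the relation `_≼_` is `Step`. For `Decreasing` it is strict at descents only,
-- which differs from `Step′` just for two equal cells.
module Increasing {m} (k : ℕ) = Ordered (Fin._<_ {m}) Fin.<-isStrictTotalOrder k
module Decreasing {m} (k : ℕ) = Ordered (flip (Fin._<_ {m})) (Flip.isStrictTotalOrder Fin.<-isStrictTotalOrder)
    k

lengths-tableau : ∀ (r : Vec (Fin m) d) (is : Vec A d) → map length (map (tableau r is) (allFin m)) ≡ map length
    (positionRows r)
lengths-tableau {m} r is =
    trans (sym (map-∘ (allFin m))) (trans (map-cong (λ ρ → length-map (lookup is) (positions r ρ)) (allFin m))
    (map-∘ (allFin m)))

column-clash : ∀ {ρ ρ′ : Fin m} {i j : Fin k} → ρ Fin.< ρ′ → i Fin.< j → ¬ Step (ρ′ , j) (ρ , i)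
column-clash _ i<j (j≤i , _) = ℕ.<⇒≱ i<j j≤i

columns-strict : ∀ (r : Vec (Fin m) d) (is : Vec (Fin K) d) → Compatible r is →
    Linked _Above_ (positionRows r) →
                 Linked _Above_ (map (tableau r is) (allFin m))
columns-strict {m} {K = K} r is c l = Linked.map⁺ (Linked.zipWith (λ { {ρ} {ρ′} (ρ<ρ′ , ab) →
    Prefix⇒Above (Prefix.map⁺ (lookup is) (lookup is)
      (prefix-map (strict ρ<ρ′) (positions-at r ρ) (positions-at r ρ′) (Above⇒Prefix ab))) })
  (increasing-allFin m , Linked.map⁻ l))
  where
  strict : ∀ {ρ ρ′ u v} → ρ Fin.< ρ′ → ρ ≡ lookup r u → ρ′ ≡ lookup r v → u Fin.< v →
      lookup is u Fin.< lookup is v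
  strict ρ<ρ′ refl refl u<v =
      proj₂ (pairs-AllPairs {a = r} {is} (Linked.Linked⇒AllPairs (Increasing.≼-trans K) c) u<v) ρ<ρ′

-- Standardization: a semistandard tableau amounts to a standard one, encoded by its lattice word,
-- with a compatible index sequence. Sorting the cells, lower rows first among equal entries,
-- recovers the word.
schur-content : ∀ μ (is : Vec (Fin K) d) → Sorted is →
  schur μ K (content (toList is)) ≡ count (λ r → compatible? r is) (latticeWords μ d)
schur-content {K} {d} μ is l =
    trans (count-filter (λ T → hasContent? α (concat T)) semistandard? (fillings K (parts μ)))
  (sym (trans (count-filter (λ r → compatible? r is) (lattice? μ) (words h d))
    (count-bijection _ _ (λ r → map (tableau r is) (allFin h)) (words-unique h d) (fillings-unique (parts μ))
      (λ {r} _ → to r) inj onto)))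
  where
  h = length (parts μ)
  α = content (toList is)
  open Increasing {h} K

  to : ∀ r → Lattice μ r × Compatible r is →
       let T = map (tableau r is) (allFin h) in T ∈ fillings K (parts μ) × Semistandard T × content (concat T) ≡ α
  to r ((shape , ab) , c) =
    subst (λ rs → T ∈ fillings K rs) (trans (lengths-tableau r is) shape) (∈-fillings⁺ T) ,
    (All.map⁺ (All.universal (λ ρ →
        Linked.AllPairs⇒Linked (subst (AllPairs Fin._≤_) (sym (tableau-row r is ρ)) (row-sorted c ρ)))
        (allFin h)) ,
     columns-strict r is c ab) ,
    content-↭ (↭-sym (rows-↭ r is (tableau r is) (↭-sym (cells-tableau r is))))
    where T = map (tableau r is) (allFin h)

  inj : ∀ {r r′} → Lattice μ r × Compatible r is → Lattice μ r′ × Compatible r′ is →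
        map (tableau r is) (allFin h) ≡ map (tableau r′ is) (allFin h) → r ≡ r′
  inj (_ , c) (_ , c′) eq = word-unique c c′ (map-allFin-injective eq)

  onto : ∀ {T} → T ∈ fillings K (parts μ) → Semistandard T × content (concat T) ≡ α →
         ∃ λ r → r ∈ words h d × (Lattice μ r × Compatible r is) × map (tableau r is) (allFin h) ≡ T
  onto {T} T∈ ((rows , cols) , eq) with rows-of {T = T}
      (trans (sym (length-map length T)) (cong length (∈-fillings⁻ (parts μ) T∈)))
  ... | t , refl = word , ∈-words word ,
      ((trans (sym (lengths-tableau word is)) (trans (cong (map length) same-rows) (∈-fillings⁻ (parts μ) T∈)) ,
          above) , ordered) , same-rows
    where
    rows′ : ∀ ρ → AllPairs Fin._≤_ (t ρ)
    rows′ ρ = Linked.Linked⇒AllPairs Fin.≤-trans (All.lookup (All.map⁻ rows) (∈-allFin ρ))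

    values-↭ : map proj₂ (sort (cells t)) ↭ concat (map t (allFin h))
    values-↭ = subst (map proj₂ (sort (cells t)) ↭_) (map-proj₂-cells t) (Perm.map⁺ proj₂ (sort-↭ (cells t)))

    values : map proj₂ (sort (cells t)) ≡ toList is
    values = sorted-by-content
        (AllPairs.map⁺ (AllPairs.map proj₁ (Linked.Linked⇒AllPairs ≼-trans (sort-↗ (cells t)))))
      (sorted-pairs is l) (content-occurrences (map proj₂ (sort (cells t))) (toList is)
          (trans (content-↭ values-↭) eq))

    open WordOf (word-of (flip Fin._<_) column-clash t rows′ (Linked.map Above⇒Prefix (Linked.map⁻ cols)) is
        values)

    same-rows : map (tableau word is) (allFin h) ≡ map t (allFin h)
    same-rows = map-cong filled (allFin h)

-- Extreme contents of tableaux and of transposed tableaux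

above-bound : ∀ {b} {us vs : List (Fin K)} → us Above vs → All (λ u → b ≤ toℕ u) us →
    All (λ v → suc b ≤ toℕ v) vs
above-bound []      _         = []
above-bound (p ∷ a) (b≤ ∷ bs) = ℕ.≤-<-trans b≤ p ∷ above-bound a bs

-- Columns increase strictly, so row number `b` has entries from `b` on only, and the rows from
-- number `k` on have none below `k`. The equation for `e`, the number of rows that still count,
-- allows recursion on it.
column-bound : ∀ b k {e} us (T : Filling K) →
               k ∸ b ≡ e → All (λ u → b ≤ toℕ u) us → Linked _Above_ (us ∷ T) →
               sum (map (λ vs → below k (map toℕ vs)) (us ∷ T)) ≤ sum (take e (map length (us ∷ T)))
column-bound b k {zero} us T eq ≥b l =
  ℕ.≤-trans (ℕ.≤-reflexive (cong₂ _+_ (below-none (All.map⁺ (All.map (ℕ.≤-trans (ℕ.m∸n≡0⇒m≤n eq)) ≥b))) refl))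
      (rest T l)
  where
  rest : ∀ T → Linked _Above_ (us ∷ T) → sum (map (λ vs → below k (map toℕ vs)) T) ≤ 0
  rest []       _       = z≤n
  rest (vs ∷ T) (a ∷ l) = column-bound (suc b) k vs T
    (trans (sym (ℕ.pred[m∸n]≡m∸[1+n] k b)) (cong pred eq)) (above-bound a ≥b) l
column-bound b k {suc e} us T eq ≥b l = ℕ.+-mono-≤
  (ℕ.≤-trans (length-filter (ℕ._<? k) (map toℕ us)) (ℕ.≤-reflexive (length-map toℕ us))) (rest T l)
  where
  rest : ∀ T → Linked _Above_ (us ∷ T) → sum (map (λ vs → below k (map toℕ vs)) T) ≤ sum (take e (map length T))
  rest []       _       = z≤n
  rest (vs ∷ T) (a ∷ l) = column-bound (suc b) k vs T
    (trans (sym (ℕ.pred[m∸n]≡m∸[1+n] k b)) (cong pred eq)) (above-bound a ≥b) l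

columns-bound : ∀ k (T : Filling K) → Linked _Above_ T → sum (map (λ vs → below k (map toℕ vs)) T) ≤ sum
    (take k (map length T))
columns-bound k []       _ = z≤n
columns-bound k (us ∷ T) l = column-bound 0 k us T refl (All.universal (λ _ → z≤n) us) l

lattice-bound : ∀ μ (r : Vec (Fin (length (parts μ))) d) (is : Vec (Fin K) d) →
                Lattice μ r → Compatible r is → ∀ k → below k (numbers is) ≤ sum (take k (parts μ))
lattice-bound μ r is (shape , ab) c k = begin
  below k (numbers is)
    ≡⟨ below-rows k r is (tableau r is) (↭-sym (cells-tableau r is)) ⟩
  sum (map (λ vs → below k (map toℕ vs)) T)      ≤⟨ columns-bound k T (columns-strict r is c ab) ⟩
  sum (take k (map length T))
    ≡⟨ cong (λ rs → sum (take k rs)) (trans (lengths-tableau r is) shape) ⟩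
  sum (take k (parts μ))                         ∎
  where
  open ℕ.≤-Reasoning
  T = map (tableau r is) (allFin _)

Step′-trans : Transitive (Step′ {m} {K})
Step′-trans {i = a , i} {a′ , i′} {a″ , i″} (le , lt) (le′ , lt′) = ℕ.≤-trans le le′ , strict
  where
  strict : a″ Fin.≤ a → i Fin.< i″
  strict a″≤a with a′ Fin.≤? a
  ... | yes a′≤a = ℕ.<-≤-trans (lt a′≤a) le′
  ... | no  a′≰a = ℕ.≤-<-trans le (lt′ (ℕ.≤-trans a″≤a (ℕ.<⇒≤ (ℕ.≰⇒> a′≰a))))

row-strict : ∀ {L : List (Fin m × Fin K)} → Linked Step′ L → ∀ ρ → AllPairs Fin._<_ (row ρ L)
row-strict {L = L} l ρ = AllPairs.map⁺ (strict
  (AllPairs.filter⁺ (λ p → ρ ≟ proj₁ p) (Linked.Linked⇒AllPairs Step′-trans l))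
  (All.all-filter (λ p → ρ ≟ proj₁ p) L))
  where
  strict : ∀ {M} → AllPairs Step′ M → All (λ p → ρ ≡ proj₁ p) M → AllPairs (Fin._<_ on proj₂) M
  strict []       []         = []
  strict (s ∷ ss) (refl ∷ e) = All.zipWith (λ { ((_ , lt) , refl) → lt ℕ.≤-refl }) (s , e) ∷ strict ss e

below-strict : ∀ b k {us : List (Fin K)} → AllPairs Fin._<_ us → All (λ u → b ≤ toℕ u) us →
    below k (map toℕ us) ≤ k ∸ b
below-strict b k []                   []        = z≤n
below-strict b k {u ∷ us} (u< ∷ us<) (b≤u ∷ _) with toℕ u ℕ.<? k
... | no  u≮k = ℕ.≤-trans (ℕ.≤-reflexive (below-none
        (ℕ.≮⇒≥ u≮k ∷ All.map⁺ (All.map (λ u<v → ℕ.≤-trans (ℕ.≮⇒≥ u≮k) (ℕ.<⇒≤ u<v)) u<)))) z≤n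
... | yes u<k = begin
  below k (toℕ u ∷ map toℕ us) ≡⟨ below-< (map toℕ us) u<k ⟩
  suc (below k (map toℕ us))   ≤⟨ s≤s (below-strict (suc b) k us< (All.map (ℕ.≤-<-trans b≤u) u<)) ⟩
  suc (k ∸ suc b)              ≡⟨ ℕ.+-∸-assoc 1 (ℕ.≤-<-trans b≤u u<k) ⟨
  k ∸ b                        ∎
  where open ℕ.≤-Reasoning

-- `Compatible′` makes the rows strictly increasing, and a strictly increasing row of length `c` has
-- at most `c ⊓ k` entries below `k`.
transposed-bound : ∀ μ (r : Vec (Fin (length (parts μ))) d) (is : Vec (Fin K) d) → Lattice μ r →
    Compatible′ r is →
                   ∀ k → below k (numbers is) ≤ ∑⊓ (parts μ) k
transposed-bound μ r is (shape , _) c k = begin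
  below k (numbers is)
    ≡⟨ below-rows k r is (tableau r is) (↭-sym (cells-tableau r is)) ⟩
  sum (map (λ vs → below k (map toℕ vs)) T)      ≤⟨ bounds (All.map⁺ (All.universal increase (allFin _))) ⟩
  ∑⊓ (map length T) k                            ≡⟨ cong (λ rs → ∑⊓ rs k) (trans (lengths-tableau r is) shape) ⟩
  ∑⊓ (parts μ) k                                 ∎
  where
  open ℕ.≤-Reasoning
  T = map (tableau r is) (allFin _)
  increase : ∀ ρ → AllPairs Fin._<_ (tableau r is ρ)
  increase ρ = subst (AllPairs Fin._<_) (sym (tableau-row r is ρ)) (row-strict c ρ)
  bounds : ∀ {T} → All (AllPairs Fin._<_) T → sum (map (λ vs → below k (map toℕ vs)) T) ≤ ∑⊓ (map length T) k
  bounds []                = z≤n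
  bounds {us ∷ _} (s ∷ ss) = ℕ.+-mono-≤
    (ℕ.⊓-glb (ℕ.≤-trans (length-filter (ℕ._<? k) (map toℕ us)) (ℕ.≤-reflexive (length-map toℕ us)))
             (below-strict 0 k s (All.universal (λ _ → z≤n) us)))
    (bounds ss)

sum-take-≤ : ∀ ps k (g : Fin (length ps) → ℕ) → (∀ ρ → toℕ ρ < k → List.lookup ps ρ ≤ g ρ) →
             sum (take k ps) ≤ sum (List.tabulate g)
sum-take-≤ ps       zero    g le = z≤n
sum-take-≤ []       (suc k) g le = z≤n
sum-take-≤ (p ∷ ps) (suc k) g le = ℕ.+-mono-≤ (le zero z<s) (sum-take-≤ ps k (g ∘ suc) λ ρ ρ<k →
    le (suc ρ) (s≤s ρ<k))

decreasing-lookup : ∀ μ → Linked (λ ρ ρ′ → List.lookup (parts μ) ρ′ ≤ List.lookup (parts μ) ρ)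
    (allFin (length (parts μ)))
decreasing-lookup μ =
    Linked.map⁻ (subst (Linked _≥_)
    (sym (trans (map-tabulate _ (List.lookup (parts μ))) (tabulate-lookup (parts μ)))) (decreasing μ))

-- A lattice word of shape `μ` reaches the bound `f`. Through the expansion, a shape that occurs
-- then forces a reduced word of `w` with an equally large content.
record Filled (μ : Partition) (R : ∀ {m d K} → Vec (Fin m) d → Vec (Fin K) d → Set) (f : ℕ → ℕ) : Set where
  field
    {size vars} : ℕ
    indices : Vec (Fin vars) size
    word    : Vec (Fin (length (parts μ))) size
    lattice : Lattice μ word
    related : R word indices
    sorted  : Sorted indices
    attain  : ∀ k → f k ≤ below k (numbers indices)

map-lookup : ∀ (xs : List A) → map (List.lookup xs) (allFin (length xs)) ≡ xs
map-lookup xs = trans (map-tabulate _ (List.lookup xs)) (tabulate-lookup xs)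

-- The tableau whose row ρ consists of ρ's.
superstandard : ∀ μ → Filled μ Compatible (λ k → sum (take k (parts μ)))
superstandard μ with Increasing.sorted-word-of (length (parts μ)) (flip Fin._<_) column-clash t rows columns
  where
  t : Fin (length (parts μ)) → List (Fin (length (parts μ)))
  t ρ = replicate (List.lookup (parts μ) ρ) ρ
  rows : ∀ ρ → AllPairs Fin._≤_ (t ρ)
  rows ρ = constant (List.lookup (parts μ) ρ)
    where
    constant : ∀ c → AllPairs Fin._≤_ (replicate c ρ)
    constant zero    = []
    constant (suc c) = All.replicate⁺ c ℕ.≤-refl ∷ constant c
  columns : Linked (λ ρ ρ′ → Prefix (flip Fin._<_) (t ρ′) (t ρ)) (allFin _)
  columns = Linked.zipWith (λ (ge , lt) → Prefix.replicate⁺ ge lt) (decreasing-lookup μ , increasing-allFin _)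
... | _ , is , w = record
  { indices = is
  ; word    = word
  ; lattice = trans (sym (lengths-tableau word is)) (trans (sym (map-∘ (allFin _)))
      (trans (map-cong (λ ρ → trans (cong length (filled ρ)) (length-replicate _)) (allFin _))
          (map-lookup (parts μ)))) , above
  ; related = ordered
  ; sorted  = compatible⇒sorted word is ordered
  ; attain  = λ k → begin
      sum (take k (parts μ))
        ≤⟨ sum-take-≤ (parts μ) k (λ ρ → below k (map toℕ (t ρ))) (λ ρ → full ρ k) ⟩
      sum (List.tabulate (λ ρ → below k (map toℕ (t ρ))))
        ≡⟨ cong sum (map-tabulate (λ ρ → ρ) (λ ρ → below k (map toℕ (t ρ)))) ⟨
      sum (map (λ ρ → below k (map toℕ (t ρ))) (allFin h))
        ≡⟨ cong sum (map-∘ {g = λ vs → below k (map toℕ vs)} {t} (allFin h)) ⟩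
      sum (map (λ vs → below k (map toℕ vs)) (map t (allFin h))) ≡⟨ below-rows k word is t perm ⟨
      below k (numbers is)                                     ∎
  }
  where
  open Increasing.WordOf (length (parts μ)) w
  open ℕ.≤-Reasoning
  h = length (parts μ)
  t : Fin h → List (Fin h)
  t ρ = replicate (List.lookup (parts μ) ρ) ρ
  full : ∀ ρ k → toℕ ρ < k → List.lookup (parts μ) ρ ≤ below k (map toℕ (t ρ))
  full ρ k ρ<k = begin
    List.lookup (parts μ) ρ   ≡⟨ length-replicate (List.lookup (parts μ) ρ) ⟨
    length (t ρ)              ≡⟨ length-map toℕ (t ρ) ⟨
    length (map toℕ (t ρ))
      ≡⟨ cong length (filter-all (ℕ._<? k) {map toℕ (t ρ)}
          (All.map⁺ (All.replicate⁺ (List.lookup (parts μ) ρ) ρ<k))) ⟨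
    below k (map toℕ (t ρ))   ∎

take-prefix : ∀ {R : A → A → Set} → (∀ x → R x x) → ∀ {c c′} → c′ ≤ c → ∀ xs → Prefix R (take c′ xs) (take c xs)
take-prefix refl-R z≤n      xs       = []
take-prefix refl-R (s≤s le) []       = []
take-prefix refl-R (s≤s le) (x ∷ xs) = refl-R x ∷ take-prefix refl-R le xs

below-suc : ∀ k xs → below (suc k) (map suc xs) ≡ below k xs
below-suc k xs = sym (count-map (ℕ._<? k) (ℕ._<? suc k) suc xs (λ _ → s≤s) (λ _ → s≤s⁻¹))

below-take : ∀ K c k → c ≤ K → c ⊓ k ≤ below k (map toℕ (take c (allFin K)))
below-take K       zero    k       _        = z≤n
below-take (suc K) (suc c) zero    _        = z≤n
below-take (suc K) (suc c) (suc k) (s≤s c≤K) = begin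
  suc (c ⊓ k)                                                ≤⟨ s≤s (below-take K c k c≤K) ⟩
  suc (below k (map toℕ (take c (allFin K))))
    ≡⟨ cong suc (below-suc k (map toℕ (take c (allFin K)))) ⟨
  suc (below (suc k) (map suc (map toℕ (take c (allFin K)))))
    ≡⟨ cong (λ l → suc (below (suc k) l)) (trans (sym (map-∘ (take c (allFin K))))
        (trans (map-∘ (take c (allFin K)))
         (cong (map toℕ) (trans (sym (take-map c (allFin K))) (cong (take c) (map-tabulate _ suc)))))) ⟩
  suc (below (suc k) (map toℕ (take c (List.tabulate suc)))) ∎
  where open ℕ.≤-Reasoning

unique-cells : {t : Fin m → List A} → (∀ ρ → Unique (t ρ)) → Unique (cells t)
unique-cells {m} {t = t} u = Unique.concat⁺
  (All.map⁺ (All.universal (λ ρ → Unique.map⁺ (λ { refl → refl }) (u ρ)) (allFin m)))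
  (AllPairs.map⁺ (AllPairs.map apart (Unique.allFin⁺ m)))
  where
  apart : ∀ {ρ ρ′} → ρ ≢ ρ′ → Disjoint (map (ρ ,_) (t ρ)) (map (ρ′ ,_) (t ρ′))
  apart {ρ} {ρ′} ρ≢ρ′ (p∈ , p∈′) with ∈-map⁻ (ρ ,_) p∈ | ∈-map⁻ (ρ′ ,_) p∈′
  ... | _ , _ , refl | _ , _ , refl = ρ≢ρ′ refl

sum-map-≤ : ∀ {f g : A → ℕ} → (∀ x → f x ≤ g x) → ∀ xs → sum (map f xs) ≤ sum (map g xs)
sum-map-≤ le []       = z≤n
sum-map-≤ le (x ∷ xs) = ℕ.+-mono-≤ (le x) (sum-map-≤ le xs)

-- The filling whose columns c consist of c's: its transpose is a tableau.
transposed-superstandard : ∀ μ → Filled μ Compatible′ (∑⊓ (parts μ))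
transposed-superstandard μ with bounded-above (parts μ)
... | K , bound with Decreasing.sorted-word-of K (flip Fin._≤_) (λ ρ<ρ′ i≤j (_ , lt) → ℕ.≤⇒≯ i≤j (lt ρ<ρ′)) t
    rows columns
  where
  t : Fin (length (parts μ)) → List (Fin K)
  t ρ = take (List.lookup (parts μ) ρ) (allFin K)
  rows : ∀ ρ → AllPairs Fin._≤_ (t ρ)
  rows ρ = AllPairs.take⁺ (List.lookup (parts μ) ρ) (AllPairs.tabulate⁺-< ℕ.<⇒≤)
  columns : Linked (λ ρ ρ′ → Prefix (flip Fin._≤_) (t ρ′) (t ρ)) (allFin _)
  columns = Linked.map (λ ge → take-prefix (λ _ → ℕ.≤-refl) ge (allFin K)) (decreasing-lookup μ)
...   | _ , is , w = record
  { indices = is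
  ; word    = word
  ; lattice = trans (sym (lengths-tableau word is)) (trans (sym (map-∘ (allFin _)))
      (trans (map-cong (λ ρ → trans (cong length (filled ρ)) (trans (length-take _ (allFin K))
        (trans (cong (List.lookup (parts μ) ρ ⊓_) (length-tabulate {n = K} _)) (ℕ.m≤n⇒m⊓n≡m (small ρ)))))
            (allFin _)) (map-lookup (parts μ)))) , above
  -- `ordered` is strict at descents only; at equal letters strictness comes from the cells being
  -- distinct.
  ; related = Linked.zipWith (λ { {p} {q} (le , p≢q) → strict p q le p≢q }) (ordered , Linked.AllPairs⇒Linked
      (unique-↭ (↭-sym perm) (unique-cells λ ρ → Unique.take⁺ _ (Unique.allFin⁺ K))))
  ; sorted  = related⇒sorted proj₁ word is ordered
  ; attain  = λ k → begin
      ∑⊓ (parts μ) k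
        ≡⟨ cong (λ ps → ∑⊓ ps k) (map-lookup (parts μ)) ⟨
      ∑⊓ (map (List.lookup (parts μ)) (allFin h)) k
        ≡⟨ cong sum (map-∘ {g = _⊓ k} {List.lookup (parts μ)} (allFin h)) ⟨
      sum (map (λ ρ → List.lookup (parts μ) ρ ⊓ k) (allFin h))
        ≤⟨ sum-map-≤ (λ ρ → below-take K (List.lookup (parts μ) ρ) k (small ρ)) (allFin h) ⟩
      sum (map (λ ρ → below k (map toℕ (t ρ))) (allFin h))
        ≡⟨ cong sum (map-∘ {g = λ vs → below k (map toℕ vs)} {t} (allFin h)) ⟩
      sum (map (λ vs → below k (map toℕ vs)) (map t (allFin h))) ≡⟨ below-rows k word is t perm ⟨
      below k (numbers is) ∎
  }
  where
  open Decreasing K using (_≼_)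
  open Decreasing.WordOf K w
  h = length (parts μ)
  t : Fin h → List (Fin K)
  t ρ = take (List.lookup (parts μ) ρ) (allFin K)
  open ℕ.≤-Reasoning hiding (strict)

  small : ∀ ρ → List.lookup (parts μ) ρ ≤ K
  small ρ = ℕ.<⇒≤ (All.lookup bound (∈-lookup ρ))

  strict : ∀ p q → p ≼ q → p ≢ q → Step′ p q
  strict (a , i) (a′ , i′) (le , lt) p≢q = le , λ a′≤a → strict′ (ℕ.m≤n⇒m<n∨m≡n a′≤a)
    where
    strict′ : a′ Fin.< a ⊎ toℕ a′ ≡ toℕ a → i Fin.< i′
    strict′ (inj₁ a′<a) = lt a′<a
    strict′ (inj₂ a′≡a) = ℕ.≤∧≢⇒< le λ i≡i′ →
        p≢q (cong₂ _,_ (sym (Fin.toℕ-injective a′≡a)) (Fin.toℕ-injective i≡i′))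

-- Comparing the extreme shapes

sum-concat : ∀ (T : List (List A)) → sum (map length T) ≡ length (concat T)
sum-concat []       = refl
sum-concat (us ∷ T) = trans (cong (length us +_) (sum-concat T)) (sym (length-++ us))

lattice-size : ∀ μ (r : Vec (Fin (length (parts μ))) d) → Lattice μ r → sum (parts μ) ≡ d
lattice-size μ r (shape , _) = begin
  sum (parts μ)                                            ≡⟨ cong sum (trans (lengths-tableau r r) shape) ⟨
  sum (map length (map (tableau r r) (allFin _)))          ≡⟨ sum-concat (map (tableau r r) (allFin _)) ⟩
  length (concat (map (tableau r r) (allFin _)))
    ≡⟨ ↭-length (rows-↭ r r (tableau r r) (↭-sym (cells-tableau r r))) ⟨
  length (toList r)                                        ≡⟨ length-toList r ⟩
  _                                                        ∎
  where open ≡-Reasoning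

partition-≡ : ∀ {μ ν} → parts μ ≡ parts ν → μ ≡ ν
partition-≡ {μ} {ν} refl
  rewrite Linked.irrelevant ℕ.≤-irrelevant (decreasing μ) (decreasing ν)
        | All.irrelevant ℕ.≤-irrelevant (positive μ) (positive ν) = refl

_≟ₚ_ : (μ ν : Partition) → Dec (μ ≡ ν)
μ ≟ₚ ν = map′ partition-≡ (cong parts) (List.≡-dec ℕ._≟_ (parts μ) (parts ν))

∑⊓-≤-sum : ∀ ps k → ∑⊓ ps k ≤ sum ps
∑⊓-≤-sum []       k = z≤n
∑⊓-≤-sum (p ∷ ps) k = ℕ.+-mono-≤ (ℕ.m⊓n≤m p k) (∑⊓-≤-sum ps k)

∑⊓-large : ∀ {ps k} → All (_≤ k) ps → ∑⊓ ps k ≡ sum ps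
∑⊓-large []       = refl
∑⊓-large (p ∷ ps) = cong₂ _+_ (ℕ.m≤n⇒m⊓n≡m p) (∑⊓-large ps)

-- The last two hypotheses say that qs dominates ps and that the transpose of qs
-- dominates the transpose of ps.
antisymmetric : ∀ {ps qs} → AllPairs _≥_ ps → All (0 <_) ps → All (0 <_) qs → sum ps ≡ sum qs →
  (∀ k → sum (take k ps) ≤ sum (take k qs)) → (∀ k → ∑⊓ ps k ≤ ∑⊓ qs k) → ps ≡ qs
antisymmetric {[]}     {[]}         _ _ _ _ _ _ = refl
antisymmetric {[]}     {q ∷ qs}     _ _ (0<q ∷ _) eq _ _ =
    contradiction (ℕ.≤-trans 0<q (ℕ.≤-trans (ℕ.m≤m+n q _) (ℕ.≤-reflexive (sym eq)))) λ ()
antisymmetric {p ∷ ps} {[]}         _ (0<p ∷ _) _ eq _ _ =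
    contradiction (ℕ.≤-trans 0<p (ℕ.≤-trans (ℕ.m≤m+n p _) (ℕ.≤-reflexive eq))) λ ()
antisymmetric {p ∷ ps} {q ∷ qs} (p≥ ∷ ps≥) (_ ∷ ps>0) (_ ∷ qs>0) eq dom dom′
  with ℕ.≤-antisym p≤q q≤p
  where
  open ℕ.≤-Reasoning
  p≤q : p ≤ q
  p≤q = subst₂ _≤_ (ℕ.+-identityʳ p) (ℕ.+-identityʳ q) (dom 1)
  -- The first `p` columns exhaust `p ∷ ps`. As the totals agree, a first row longer than `p` would
  -- leave cells of `q ∷ qs` uncounted, against `dom′ p`.
  q≤p : q ≤ p
  q≤p = ℕ.+-cancelʳ-≤ (sum qs) q p (begin
    q + sum qs           ≡⟨ eq ⟨
    p + sum ps           ≡⟨ ∑⊓-large (ℕ.≤-refl ∷ p≥) ⟨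
    ∑⊓ (p ∷ ps) p        ≤⟨ dom′ p ⟩
    q ⊓ p + ∑⊓ qs p      ≤⟨ ℕ.+-mono-≤ (ℕ.m⊓n≤n q p) (∑⊓-≤-sum qs p) ⟩
    p + sum qs           ∎)
... | refl = cong (p ∷_) (antisymmetric ps≥ ps>0 qs>0 (ℕ.+-cancelˡ-≡ p _ _ eq)
  (λ k → ℕ.+-cancelˡ-≤ p _ _ (dom (suc k))) (λ k → ℕ.+-cancelˡ-≤ (p ⊓ k) _ _ (dom′ k)))

-- Extreme shapes of a Schur expansion

∈⇒≤sum : ∀ (f : A → ℕ) {x xs} → x ∈ xs → f x ≤ sum (map f xs)
∈⇒≤sum f (here refl) = ℕ.m≤m+n _ _
∈⇒≤sum f (there x∈)  = ℕ.≤-trans (∈⇒≤sum f x∈) (ℕ.m≤n+m _ _)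

sum≡1 : ∀ (f : A → ℕ) xs → sum (map f xs) ≡ 1 → ∃ λ x → x ∈ xs × f x ≡ 1
sum≡1 f (x ∷ xs) eq with f x in fx
... | suc zero = x , here refl , fx
... | zero     with sum≡1 f xs eq
...   | y , y∈ , fy = y , there y∈ , fy

remove : ∀ {x : A} {xs} → x ∈ xs → ∃ λ ys → xs ↭ x ∷ ys
remove x∈ with ∈-∃++ x∈
... | ys , zs , refl = ys ++ zs , shift _ ys zs

other : ∀ {x y : A} {ys} → y ∈ x ∷ ys → y ≢ x → y ∈ ys
other (here y≡x) y≢x = contradiction y≡x y≢x
other (there y∈) _   = y∈

three-≤-sum : ∀ (f : A → ℕ) {x y z xs} → x ∈ xs → y ∈ xs → z ∈ xs → x ≢ y → x ≢ z → y ≢ z →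
              f x + (f y + f z) ≤ sum (map f xs)
three-≤-sum f x∈ y∈ z∈ x≢y x≢z y≢z with remove x∈
... | ys , p with remove (other (∈-resp-↭ p y∈) (x≢y ∘ sym))
...   | zs , q = ℕ.≤-trans
  (ℕ.+-monoʳ-≤ (f _) (ℕ.≤-trans
      (ℕ.+-monoʳ-≤ (f _) (∈⇒≤sum f (other (∈-resp-↭ q (other (∈-resp-↭ p z∈) (x≢z ∘ sym))) (y≢z ∘ sym))))
    (ℕ.≤-reflexive (sym (sum-↭ (Perm.map⁺ f q))))))
  (ℕ.≤-reflexive (sym (sum-↭ (Perm.map⁺ f p))))

count>0 : (P? : Decidable P) → ∀ {x xs} → x ∈ xs → P x → 0 < count P? xs
count>0 P? (here {xs = xs} refl) px = ℕ.≤-trans (s≤s z≤n) (ℕ.≤-reflexive (sym (count-yes P? xs px)))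
count>0 P? {xs = y ∷ xs} (there x∈)  px with P? y
... | yes _ = s≤s z≤n
... | no  _ = count>0 P? x∈ px

count>0⁻ : (P? : Decidable P) → ∀ xs → 0 < count P? xs → ∃ λ x → x ∈ xs × P x
count>0⁻ P? (x ∷ xs) lt with P? x
... | yes px = x , here refl , px
... | no  _  with count>0⁻ P? xs lt
...   | y , y∈ , py = y , there y∈ , py

reduced-size : ∀ (w : Permutation′ n) {d e} (a : Vec (Fin (pred n)) d) (b : Vec (Fin (pred n)) e) →
    Reduced w a → Reduced w b → d ≡ e
reduced-size w a b (eq , min) (eq′ , min′) = ℕ.≤-antisym (min b eq′) (min′ a eq)

supported : ∀ {f} (E : SchurExpansion f) {μ} → coeff E μ ≢ 0 → μ ∈ support E
supported E {μ} ≢0 = decidable-stable (_∈?_ _≟ₚ_ μ (support E)) (≢0 ∘ outside E)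

-- `bounding μ` stands for the partial sums of `μ` or of its transpose, so that `extreme` dominates
-- every shape that occurs, in one of these two senses.
record Extremal {f : Series} (E : SchurExpansion f) (bounding : Partition → ℕ → ℕ) : Set where
  field
    top      : ℕ → ℕ
    size     : ℕ
    bounded  : ∀ {μ} → coeff E μ ≢ 0 → ∀ k → bounding μ k ≤ top k
    sized    : ∀ {μ} → coeff E μ ≢ 0 → sum (parts μ) ≡ size
    extreme  : Partition
    once     : coeff E extreme ≡ 1
    attained : ∀ k → top k ≤ bounding extreme k

module _ {w : Permutation′ n} (E : SchurExpansion (stanley w))
  (R : ∀ {m d K} → Vec (Fin m) d → Vec (Fin K) d → Set)
  (R? : ∀ {m d K} (a : Vec (Fin m) d) (is : Vec (Fin K) d) → Dec (R a is))
  (R⇒sorted : ∀ {m d K} (a : Vec (Fin m) d) (is : Vec (Fin K) d) → R a is → Sorted is)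
  (bounding : Partition → ℕ → ℕ)
  (bounded : ∀ {d K} μ (r : Vec (Fin (length (parts μ))) d) (is : Vec (Fin K) d) → Lattice μ r → R r is →
             ∀ k → below k (numbers is) ≤ bounding μ k)
  (filled : ∀ μ → Filled μ R (bounding μ))
  (dominated : Dominated w R)
  (expand : ∀ {d K} (is : Vec (Fin K) d) → Sorted is → count (λ a → R? a is) (Red w d) ≡
            sum (map (λ μ → coeff E μ * count (λ r → R? r is) (latticeWords μ d)) (support E)))
  where

  private module D = Dominated dominated

  -- No term of the expansion can cancel another, so the extreme content of `μ` is also attained by
  -- a reduced word of `w`, to which `dominate` applies.
  below-top : ∀ {μ} → coeff E μ ≢ 0 → (∀ k → bounding μ k ≤ D.top k) × sum (parts μ) ≡ D.size
  below-top {μ} ≢0 = (λ k → ℕ.≤-trans (F.attain k) (D.dominate word F.indices red rel k)) ,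
                     trans (lattice-size μ F.word F.lattice) (reduced-size w word D.word red D.reduced)
    where
    module F = Filled (filled μ)
    N = count (λ r → R? r F.indices) (latticeWords μ F.size)
    N>0 : 0 < N
    N>0 = count>0 _ (∈-filter⁺ (lattice? μ) (∈-words F.word) F.lattice) F.related
    found = count>0⁻ (λ a → R? a F.indices) (Red w F.size) (begin
      1                   ≤⟨ ℕ.*-mono-≤ (ℕ.n≢0⇒n>0 ≢0) N>0 ⟩
      coeff E μ * N
        ≤⟨ ∈⇒≤sum (λ μ → coeff E μ * count (λ r → R? r F.indices) (latticeWords μ F.size)) (supported E ≢0) ⟩
      _                   ≡⟨ expand F.indices F.sorted ⟨
      _                   ∎)
      where open ℕ.≤-Reasoning
    word = proj₁ found
    rel = proj₂ (proj₂ found)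
    red = proj₂ (∈-filter⁻ (reduced? w) {xs = words (pred n) F.size} (proj₁ (proj₂ found)))

  -- The extreme content of `w` is counted once, and a sum of products of natural numbers equals 1
  -- only through a single product 1 · 1. Its second factor provides a lattice word, and `bounded`
  -- for that word gives the inequality.
  top-shape : ∃ λ μ → coeff E μ ≡ 1 × (∀ k → D.top k ≤ bounding μ k)
  top-shape with sum≡1 _ (support E) (trans (sym (expand D.indices (R⇒sorted D.word D.indices D.related)))
    (trans (count-filter (λ a → R? a D.indices) (reduced? w) (words (pred n) D.size))
      (count-one _ (words-unique (pred n) D.size) (∈-words D.word) (D.reduced , D.related) λ a (red , rel) →
          D.only a red rel)))
  ... | μ , _ , eq with count>0⁻ (λ r → R? r D.indices) (latticeWords μ D.size)
      (ℕ.≤-reflexive (sym (ℕ.m*n≡1⇒n≡1 (coeff E μ) _ eq)))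
  ...   | r , r∈ , rel = μ , ℕ.m*n≡1⇒m≡1 (coeff E μ) _ eq , λ k → ℕ.≤-trans (D.attain k)
    (bounded μ r D.indices (proj₂ (∈-filter⁻ (lattice? μ) {xs = words (length (parts μ)) D.size} r∈)) rel k)

  extremal : Extremal E bounding
  extremal = record
    { top = D.top ; size = D.size
    ; bounded = λ ≢0 → proj₁ (below-top ≢0) ; sized = λ ≢0 → proj₂ (below-top ≢0)
    ; extreme = proj₁ top-shape ; once = proj₁ (proj₂ top-shape) ; attained = proj₂ (proj₂ top-shape) }

compatible-expansion : ∀ {w : Permutation′ n} (E : SchurExpansion (stanley w)) →
  (is : Vec (Fin K) d) → Sorted is →
  count (λ a → compatible? a is) (Red w d) ≡
  sum (map (λ μ → coeff E μ * count (λ r → compatible? r is) (latticeWords μ d)) (support E))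
compatible-expansion {w = w} E is l =
    trans (sym (stanley-content w is l)) (trans (expands E _ (content (toList is)))
  (cong sum (map-cong (λ μ → cong (coeff E μ *_) (schur-content μ is l)) (support E))))

-- The definitions give only the counts for `Compatible`; they determine how the ascent sets are
-- distributed on both sides, and this distribution determines the counts for `Compatible′`.
compatible′-expansion : ∀ {w : Permutation′ n} (E : SchurExpansion (stanley w)) →
  (is : Vec (Fin K) d) → Sorted is →
  count (λ a → compatible′? a is) (Red w d) ≡
  sum (map (λ μ → coeff E μ * count (λ r → compatible′? r is) (latticeWords μ d)) (support E))
compatible′-expansion {d = d} {w} E = ω-expansion (Red w d)
  (coeff E) (λ μ → length (parts μ)) (λ μ → latticeWords μ d) (support E)
  (compatible-expansion {w = w} E)

rows-extremal : ∀ {w : Permutation′ n} (E : SchurExpansion (stanley w)) →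
                Extremal E (λ μ k → sum (take k (parts μ)))
rows-extremal {w = w} E = extremal {w = w} E
  Compatible compatible? compatible⇒sorted (λ μ k → sum (take k (parts μ)))
  lattice-bound superstandard (compatible-dominated w) (compatible-expansion {w = w} E)

columns-extremal : ∀ {w : Permutation′ n} (E : SchurExpansion (stanley w)) →
                   Extremal E (λ μ → ∑⊓ (parts μ))
columns-extremal {w = w} E = extremal {w = w} E
  Compatible′ compatible′? compatible′⇒sorted (λ μ → ∑⊓ (parts μ))
  transposed-bound transposed-superstandard (compatible′-dominated w) (compatible′-expansion {w = w} E)

lemma7p1 : ∀ (n : ℕ) (w : Permutation′ n) (E : SchurExpansion (stanley w)) →
    Vexillary 3 w E → MultiplicityFree w E
lemma7p1 n w E EG≤3 μ c≢0 = decidable-stable (coeff E μ ℕ.≟ 1) λ c≢1 →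
    c≢1 (subst (λ ν → coeff E ν ≡ 1) (sym (same-shape c≢1)) Rows.once)
  where
  module Rows = Extremal (rows-extremal {w = w} E)
  module Columns = Extremal (columns-extremal {w = w} E)

  supported-once : ∀ {ν} → coeff E ν ≡ 1 → ν ∈ support E
  supported-once c≡1 = supported E λ c≡0 → contradiction (trans (sym c≡1) c≡0) λ ()

  distinct : coeff E μ ≢ 1 → ∀ {ν} → coeff E ν ≡ 1 → μ ≢ ν
  distinct c≢1 c≡1 refl = c≢1 c≡1

  same-extreme : coeff E μ ≢ 1 → Rows.extreme ≡ Columns.extreme
  same-extreme c≢1 = decidable-stable (Rows.extreme ≟ₚ Columns.extreme) λ R≢C → ℕ.<⇒≱ (begin
    2 + (1 + 1)
      ≤⟨ ℕ.+-monoˡ-≤ 2 (ℕ.≤∧≢⇒< (ℕ.n≢0⇒n>0 c≢0) (c≢1 ∘ sym)) ⟩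
    coeff E μ + (1 + 1)
      ≡⟨ cong (coeff E μ +_) (cong₂ _+_ Rows.once Columns.once) ⟨
    coeff E μ + (coeff E Rows.extreme + coeff E Columns.extreme)
      ≤⟨ three-≤-sum (coeff E)
           (supported E c≢0) (supported-once Rows.once) (supported-once Columns.once)
           (distinct c≢1 Rows.once) (distinct c≢1 Columns.once) R≢C ⟩
    EG E ∎) EG≤3
    where open ℕ.≤-Reasoning

  once≢0 : coeff E Rows.extreme ≢ 0
  once≢0 c≡0 = contradiction (trans (sym Rows.once) c≡0) λ ()

  same-shape : coeff E μ ≢ 1 → μ ≡ Rows.extreme
  same-shape c≢1 = partition-≡ (antisymmetric
    (Linked.Linked⇒AllPairs (λ p q → ℕ.≤-trans q p) (decreasing μ)) (positive μ) (positive Rows.extreme)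
    (trans (Rows.sized c≢0) (sym (Rows.sized once≢0)))
    (λ k → ℕ.≤-trans (Rows.bounded c≢0 k) (Rows.attained k))
    (λ k → ℕ.≤-trans (Columns.bounded c≢0 k)
      (subst (λ ν → Columns.top k ≤ ∑⊓ (parts ν) k) (sym (same-extreme c≢1)) (Columns.attained k))))
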